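{- Let $n\ge1$. There exists a bijection $\Psi:\mathcal P_n\to\mathcal P_n$ that preserves the triple of statistics $(\mathsf{larm},\mathsf{rarm},\mathsf{leaf})$ and transforms the statistic $\mathsf{rev}$ to $\mathsf{run}$, i.e. $\mathsf{rev}(T)=\mathsf{run}(\Psi(T))$ for all $T\in\mathcal P_n$. Consequently, $$C_n(x,y,z):=\sum_{T\in\mathcal P_n}x^{\mathsf{larm}(T)-1}y^{\mathsf{rarm}(T)-1}z^{\mathsf{rev}(T)-1}$$ is a symmetric function in $x,y$ and $z$.
   Context: A plane tree is a rooted tree in which the children of each node are linearly ordered (left to right); $\mathcal P_n$ is the set of plane trees with $n$ edges. A node without children is a leaf. A sibling of a node lying to its right is a younger sibling. Preorder on $T$: recursively visit the parent, then the subtrees of its children from left to right; the reverse preorder is the reversal of the preorder. Statistics of $T\in\mathcal P_n$: - $\mathsf{larm}(T)$: number of edges of the left arm, i.e. the path starting at the root and going repeatedly to the leftmost child until a leaf is reached. - $\mathsf{rarm}(T)$: number of edges of the right arm, defined in the same way with rightmost children. - $\mathsf{leaf}(T)$: number of leaves. - $\mathsf{rev}(T)$: number of nodes before the first node, under the reverse preorder, that has a younger sibling; by convention $\mathsf{rev}(T)=n$ if $T$ is the path with $n$ edges. - $\mathsf{run}(T)$: number of non-leaf nodes after (and including) the last node in preorder that has at least two children; by convention $\mathsf{run}(T)=n$ if $T$ is the path with $n$ edges. -}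

module Defs where

open import Data.Bool.Base using (Bool; true; false; not; if_then_else_)
open import Data.Bool.ListAction using (any)
open import Data.Fin.Permutation using (Permutation′; _⟨$⟩ˡ_)
open import Data.Integer.Base as ℤ using (ℤ; 0ℤ; 1ℤ)
open import Data.List.Base using (List; []; _∷_; _++_; map; concatMap; length; null; reverse; takeWhileᵇ; filterᵇ)
open import Data.List.Membership.Propositional using (_∈_; find; lose)
open import Data.List.Membership.Propositional.Properties using (∈-map⁺; ∈-map⁻; ∈-concatMap⁺; ∈-concatMap⁻)
open import Data.List.Relation.Unary.All as All using ([]; _∷_)
import Data.List.Relation.Unary.All.Properties as All
open import Data.List.Relation.Unary.AllPairs as AllPairs using ([]; _∷_)
import Data.List.Relation.Unary.AllPairs.Properties as AllPairs
open import Data.List.Relation.Unary.Any using (here; there)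
open import Data.List.Relation.Unary.Unique.Propositional using (Unique)
import Data.List.Relation.Unary.Unique.Propositional.Properties as Unique
open import Data.Nat.Base using (ℕ; zero; suc; _+_; _∸_; _≤ᵇ_)
import Data.Nat.Properties as ℕ
open import Data.Product.Base using (Σ; _×_; _,_)
open import Data.Vec.Base using (Vec; []; _∷_; lookup; tabulate)
open import Data.Vec.Properties using (≡-dec)
open import Function.Base using (_∘_)
open import Function.Bundles using (_⇔_; mk⇔)
open import Relation.Binary.PropositionalEquality using (_≡_; refl; sym; trans; cong)
open import Relation.Nullary.Decidable using (does)

------------------------------------------------------------------------
-- Plane trees

data Tree : Set where
  node : List Tree → Tree

Forest : Set
Forest = List Tree

children : Tree → Forest
children (node ts) = ts

-- In a forest, every root also counts the edge joining it to the (absent)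
-- parent.
mutual
  edges : Tree → ℕ
  edges (node ts) = edgesᶠ ts

  edgesᶠ : Forest → ℕ
  edgesᶠ []       = 0
  edgesᶠ (t ∷ ts) = suc (edges t + edgesᶠ ts)

𝒫 : ℕ → Set
𝒫 n = Σ Tree λ T → edges T ≡ n

isPath : Tree → Bool
isPath (node [])           = true
isPath (node (t ∷ []))     = isPath t
isPath (node (_ ∷ _ ∷ _))  = false

------------------------------------------------------------------------
-- Nodes in preorder

-- A node of a tree is recorded through the subtree rooted at it and the
-- list of (the subtrees at) its younger siblings.
record Node : Set where
  constructor mkNode
  field
    subtree : Tree
    younger : Forest

isLeaf : Node → Bool
isLeaf = null ∘ children ∘ Node.subtree

hasYounger : Node → Bool
hasYounger = not ∘ null ∘ Node.younger

isBranching : Node → Bool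
isBranching ν = 2 ≤ᵇ length (children (Node.subtree ν))

mutual
  preorderFrom : Tree → Forest → List Node
  preorderFrom (node ts) ys = mkNode (node ts) ys ∷ preorderᶠ ts

  preorderᶠ : Forest → List Node
  preorderᶠ []       = []
  preorderᶠ (t ∷ ts) = preorderFrom t ts ++ preorderᶠ ts

preorder : Tree → List Node
preorder T = preorderFrom T []

------------------------------------------------------------------------
-- Statistics

larm : Tree → ℕ
larm (node [])      = 0
larm (node (t ∷ _)) = suc (larm t)

mutual
  rarm : Tree → ℕ
  rarm (node [])       = 0
  rarm (node (t ∷ ts)) = suc (rarmOfLast t ts)

  rarmOfLast : Tree → Forest → ℕ
  rarmOfLast t []       = rarm t
  rarmOfLast _ (u ∷ us) = rarmOfLast u us

leaf : Tree → ℕ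
leaf T = length (filterᵇ isLeaf (preorder T))

rev : Tree → ℕ
rev T = if isPath T then edges T
        else length (takeWhileᵇ (not ∘ hasYounger) (reverse (preorder T)))

-- The suffix starting at the last element satisfying p ([] if none does).
fromLastᵇ : {A : Set} → (A → Bool) → List A → List A
fromLastᵇ p []       = []
fromLastᵇ p (x ∷ xs) =
  if any p xs then fromLastᵇ p xs
  else if p x then x ∷ xs else []

run : Tree → ℕ
run T = if isPath T then edges T
        else length (filterᵇ (not ∘ isLeaf) (fromLastᵇ isBranching (preorder T)))

------------------------------------------------------------------------
-- Enumeration of 𝒫 n

-- grow ts lists the forests from which ts is obtained by deleting the leaf
-- at the end of the left arm of the first tree.
mutual
  grow : Forest → List Forest
  grow ts = (node [] ∷ ts) ∷ growHead ts

  growHead : Forest → List Forest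
  growHead []             = []
  growHead (node us ∷ ts) = map (λ us′ → node us′ ∷ ts) (grow us)

forests : ℕ → List Forest
forests zero    = [] ∷ []
forests (suc n) = concatMap grow (forests n)

-- By ∈-trees and trees-unique below, trees n lists every element of 𝒫 n
-- exactly once.
trees : ℕ → List Tree
trees n = map node (forests n)

private
  shrink : Forest → Forest
  shrink []                   = []
  shrink (node [] ∷ ts)       = ts
  shrink (node (u ∷ us) ∷ ts) = node (shrink (u ∷ us)) ∷ ts

  shrink-node : ∀ {us′} us ts → us′ ∈ grow us →
                shrink (node us′ ∷ ts) ≡ node (shrink us′) ∷ ts
  shrink-node us             ts (here refl) = refl
  shrink-node (node vs ∷ us) ts (there p) with ∈-map⁻ _ p
  ... | _ , _ , refl = refl

  shrink-grow : ∀ {ts′} ts → ts′ ∈ grow ts → shrink ts′ ≡ ts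
  shrink-grow ts             (here refl) = refl
  shrink-grow (node us ∷ ts) (there p) with ∈-map⁻ _ p
  ... | us′ , q , refl =
    trans (shrink-node us ts q) (cong (λ vs → node vs ∷ ts) (shrink-grow us q))

  grow-shrink : ∀ t ts → (t ∷ ts) ∈ grow (shrink (t ∷ ts))
  grow-shrink (node [])       ts = here refl
  grow-shrink (node (u ∷ us)) ts =
    there (∈-map⁺ (λ us′ → node us′ ∷ ts) (grow-shrink u us))

  edges-grow : ∀ {ts′} ts → ts′ ∈ grow ts → edgesᶠ ts′ ≡ suc (edgesᶠ ts)
  edges-grow ts             (here refl) = refl
  edges-grow (node us ∷ ts) (there p) with ∈-map⁻ _ p
  ... | us′ , q , refl = cong (λ k → suc (k + edgesᶠ ts)) (edges-grow us q)

  ∈-forests⁻ : ∀ n {ts} → ts ∈ forests n → edgesᶠ ts ≡ n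
  ∈-forests⁻ zero    (here refl) = refl
  ∈-forests⁻ (suc n) p with find (∈-concatMap⁻ grow {xs = forests n} p)
  ... | ts , q , r = trans (edges-grow ts r) (cong suc (∈-forests⁻ n q))

  ∈-forests⁺ : ∀ n ts → edgesᶠ ts ≡ n → ts ∈ forests n
  ∈-forests⁺ zero    []       refl = here refl
  ∈-forests⁺ (suc n) (t ∷ ts) eq   =
    ∈-concatMap⁺ grow (lose (∈-forests⁺ n (shrink (t ∷ ts)) eq′) p)
    where
    p   = grow-shrink t ts
    eq′ = ℕ.suc-injective (trans (sym (edges-grow _ p)) eq)

  grow-unique : ∀ ts → Unique (grow ts)
  grow-unique []             = [] ∷ []
  grow-unique (node us ∷ ts) =
    All.map⁺ (All.universal (λ _ ()) (grow us))
    ∷ Unique.map⁺ (λ { refl → refl }) (grow-unique us)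

  forests-unique : ∀ n → Unique (forests n)
  forests-unique zero    = [] ∷ []
  forests-unique (suc n) = Unique.concat⁺
    (All.map⁺ (All.universal grow-unique (forests n)))
    (AllPairs.map⁺ (AllPairs.map
      (λ { x≢y (p , q) → x≢y (trans (sym (shrink-grow _ p)) (shrink-grow _ q)) })
      (forests-unique n)))

∈-trees : ∀ {n T} → T ∈ trees n ⇔ edges T ≡ n
∈-trees {n} {node ts} = mk⇔ to (∈-map⁺ node ∘ ∈-forests⁺ n ts)
  where
  to : node ts ∈ trees n → edgesᶠ ts ≡ n
  to p with ∈-map⁻ node p
  ... | _ , q , refl = ∈-forests⁻ n q

trees-unique : ∀ n → Unique (trees n)
trees-unique n = Unique.map⁺ (λ { refl → refl }) (forests-unique n)

------------------------------------------------------------------------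
-- Polynomials with integer coefficients in k variables

Exponents : ℕ → Set
Exponents k = Vec ℕ k

-- A formal sum of terms c · x₀^e₀ ⋯ xₖ₋₁^eₖ₋₁; the same exponent vector may
-- occur several times, so polynomials are compared by _≈_, not by _≡_.
Poly : ℕ → Set
Poly k = List (ℤ × Exponents k)

coeff : ∀ {k} → Poly k → Exponents k → ℤ
coeff []            e = 0ℤ
coeff ((c , d) ∷ p) e =
  (if does (≡-dec ℕ._≟_ d e) then c else 0ℤ) ℤ.+ coeff p e

infix 4 _≈_
_≈_ : ∀ {k} → Poly k → Poly k → Set
p ≈ q = ∀ e → coeff p e ≡ coeff q e

monomial : ∀ {k} → Exponents k → Poly k
monomial e = (1ℤ , e) ∷ []

-- The sum of f a over all a in a list; addition of formal sums is _++_.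
∑ : ∀ {k} {A : Set} → List A → (A → Poly k) → Poly k
∑ as f = concatMap f as

-- Substitution of the variable x_{σ i} for x_i.
permuteVars : ∀ {k} → Permutation′ k → Poly k → Poly k
permuteVars σ = map λ { (c , e) → c , tabulate λ j → lookup e (σ ⟨$⟩ˡ j) }

Symmetric : ∀ {k} → Poly k → Set
Symmetric {k} p = (σ : Permutation′ k) → permuteVars σ p ≈ p

-- For n ≥ 1 all three statistics are positive on 𝒫 n, so _∸_ does not
-- truncate there.
C : ℕ → Poly 3
C n = ∑ (trees n) λ T → monomial (larm T ∸ 1 ∷ rarm T ∸ 1 ∷ rev T ∸ 1 ∷ [])

{-# OPTIONS --safe #-}

-- Cut a tree at its last leaf: every tree with an edge arises uniquely from a
-- smaller tree S by attaching a path with b + 1 edges to the node at depth h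
-- of the right arm of S, as its rightmost branch.  In terms of these data, rev
-- and run satisfy the same recursion up to a shift e: it compares h with the
-- depth g at which S in turn was obtained from a tree S′.  Reflecting g in the
-- interval [h + e, rarm S′ - 1] whenever it lies there turns the recursion
-- into the closed form gap T = rarm S - 1 - h + b, two less than the distance
-- between the last two leaves.  So rev (e = 1) and run (e = 0) are each carried
-- to the same statistic by bijections that keep all path lengths b and the
-- right arm, hence larm, rarm and leaf; Ψ composes one with the inverse of the
-- other.
--
-- For the symmetry, rev may be replaced by gap + 1.  Replacing h by
-- rarm S - 1 - h exchanges rarm and gap + 1.  Regarding the tree as planted,
-- rerooting it at its last leaf and taking the mirror image exchanges larm and
-- gap + 1, since it swaps the first leaf with the last but one.
module Submission where

open import Defs
open import Data.Nat.Base using (ℕ; _≤_)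
open import Data.Product.Base using (Σ-syntax; _×_; proj₁)
open import Function.Bundles using (_⤖_; module Bijection)
open import Relation.Binary.PropositionalEquality using (_≡_)

open import Data.Bool.Base using (Bool; true; false; not; _∨_; if_then_else_)
open import Data.Bool.ListAction using (any)
open import Data.Bool.Properties using (if-eta; ∨-zeroʳ)
open import Data.Fin.Base using (Fin)
open import Data.Fin.Patterns using (0F; 1F; 2F)
open import Data.Fin.Permutation using (Permutation′; _⟨$⟩ʳ_; _⟨$⟩ˡ_; transpose; flip)
open import Data.Fin.Permutation.Transposition.List using (eval; decompose; eval-decompose)
open import Data.Integer.Base as ℤ using (ℤ; 0ℤ; 1ℤ)
import Data.Integer.Properties as ℤ
open import Algebra.Properties.CommutativeSemigroup ℤ.+-commutativeSemigroup using (x∙yz≈y∙xz)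
open import Data.List.Base using (List; []; _∷_; _++_; _∷ʳ_; _ʳ++_; map; length; null; reverse; filterᵇ; takeWhileᵇ)
open import Data.List.Membership.Propositional using (_∈_)
open import Data.List.Membership.Propositional.Properties using (∈-map⁺; ∈-map⁻)
open import Data.List.Membership.Propositional.Properties.WithK using (unique∧set⇒bag)
open import Data.List.Properties using (++-assoc; ++-identityʳ; map-++; concatMap-map; concatMap-cong)
open import Data.List.Relation.Binary.BagAndSetEquality using (∼bag⇒↭)
open import Data.List.Relation.Binary.Permutation.Propositional as ↭ using (_↭_)
import Data.List.Relation.Unary.Unique.Propositional.Properties as Unique
open import Data.Nat.Base using (zero; suc; pred; _+_; _∸_; _<_; _≤ᵇ_; z≤n; s≤s)
open import Data.Nat.Properties as ℕ using (_≤?_; _<?_)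
open import Data.Product.Base using (∃; _,_; proj₂)
open import Data.Sum.Base using (_⊎_; inj₁; inj₂)
open import Data.Vec.Base using ([]; _∷_; lookup; tabulate)
open import Data.Vec.Properties using (≡-dec; tabulate-cong; lookup∘tabulate)
open import Function.Base using (_∘_; id)
open import Function.Bundles using (_↔_; mk↔ₛ′; mk⇔; module Inverse; module Equivalence)
open import Function.Construct.Composition using (_↔-∘_)
open import Function.Construct.Identity using (↔-id)
open import Function.Construct.Symmetry using (↔-sym)
open import Function.Properties.Inverse using (↔⇒⤖)
open import Relation.Binary.PropositionalEquality using (refl; sym; trans; cong; cong₂; subst; module ≡-Reasoning)
open import Relation.Nullary.Decidable using (does; yes; no; recompute; dec-true; dec-false)

-- Plane trees presented from the right

-- Forests read from the right: F ▷ G is F followed by a tree whose root has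
-- the forest G of children.
infixl 5 _▷_
data SForest : Set where
  ε   : SForest
  _▷_ : SForest → SForest → SForest

⟦_⟧ : SForest → Forest
⟦ ε ⟧     = []
⟦ F ▷ G ⟧ = ⟦ F ⟧ ∷ʳ node ⟦ G ⟧

unloadOnto : SForest → Forest → SForest
unloadOnto F []             = F
unloadOnto F (node us ∷ ts) = unloadOnto (F ▷ unloadOnto ε us) ts

⟦unloadOnto⟧ : ∀ F ts → ⟦ unloadOnto F ts ⟧ ≡ ⟦ F ⟧ ++ ts
⟦unloadOnto⟧ F []             = sym (++-identityʳ ⟦ F ⟧)
⟦unloadOnto⟧ F (node us ∷ ts) = begin
  ⟦ unloadOnto (F ▷ unloadOnto ε us) ts ⟧    ≡⟨ ⟦unloadOnto⟧ (F ▷ unloadOnto ε us) ts ⟩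
  (⟦ F ⟧ ∷ʳ node ⟦ unloadOnto ε us ⟧) ++ ts  ≡⟨ ++-assoc ⟦ F ⟧ _ ts ⟩
  ⟦ F ⟧ ++ node ⟦ unloadOnto ε us ⟧ ∷ ts     ≡⟨ cong (λ vs → ⟦ F ⟧ ++ node vs ∷ ts) (⟦unloadOnto⟧ ε us) ⟩
  ⟦ F ⟧ ++ node us ∷ ts                      ∎
  where open ≡-Reasoning

unloadOnto-++ : ∀ F ts us → unloadOnto F (ts ++ us) ≡ unloadOnto (unloadOnto F ts) us
unloadOnto-++ F []             us = refl
unloadOnto-++ F (node vs ∷ ts) us = unloadOnto-++ (F ▷ unloadOnto ε vs) ts us

unloadOnto-⟦⟧ : ∀ F → unloadOnto ε ⟦ F ⟧ ≡ F
unloadOnto-⟦⟧ ε       = refl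
unloadOnto-⟦⟧ (F ▷ G) = trans (unloadOnto-++ ε ⟦ F ⟧ _)
  (cong₂ _▷_ (unloadOnto-⟦⟧ F) (unloadOnto-⟦⟧ G))

tree : SForest → Tree
tree F = node ⟦ F ⟧

-- The statistics on forests read from the right

larmˢ rarmˢ edgesˢ leafˢ : SForest → ℕ
larmˢ ε               = 0
larmˢ (ε ▷ G)         = suc (larmˢ G)
larmˢ (F@(_ ▷ _) ▷ G) = larmˢ F

rarmˢ ε       = 0
rarmˢ (F ▷ G) = suc (rarmˢ G)

edgesˢ ε       = 0
edgesˢ (F ▷ G) = suc (edgesˢ F + edgesˢ G)

-- A forest stands for the tree having it as its children; `ε` is a single vertex, which is a leaf.
leafˢ ε               = 1
leafˢ (ε ▷ G)         = leafˢ G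
leafˢ (F@(_ ▷ _) ▷ G) = leafˢ F + leafˢ G

larm-tree : ∀ F → larm (tree F) ≡ larmˢ F
larm-tree ε       = refl
larm-tree (ε ▷ G) = cong suc (larm-tree G)
larm-tree (F@(F′ ▷ H) ▷ G) = trans (larm-∷ʳ² ⟦ F′ ⟧) (larm-tree F)
  where
  larm-∷ʳ² : ∀ ts {t u} → larm (node ((ts ∷ʳ t) ∷ʳ u)) ≡ larm (node (ts ∷ʳ t))
  larm-∷ʳ² []      = refl
  larm-∷ʳ² (_ ∷ _) = refl

rarm-∷ʳ : ∀ ts t → rarm (node (ts ∷ʳ t)) ≡ suc (rarm t)
rarm-∷ʳ []       t = refl
rarm-∷ʳ (u ∷ us) t = cong suc (last u us)
  where
  last : ∀ u us → rarmOfLast u (us ∷ʳ t) ≡ rarm t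
  last u []       = refl
  last u (v ∷ vs) = last v vs

rarm-tree : ∀ F → rarm (tree F) ≡ rarmˢ F
rarm-tree ε       = refl
rarm-tree (F ▷ G) = trans (rarm-∷ʳ ⟦ F ⟧ _) (cong suc (rarm-tree G))

edgesᶠ-++ : ∀ ts us → edgesᶠ (ts ++ us) ≡ edgesᶠ ts + edgesᶠ us
edgesᶠ-++ []       us = refl
edgesᶠ-++ (t ∷ ts) us = cong suc (trans (cong (edges t +_) (edgesᶠ-++ ts us))
  (sym (ℕ.+-assoc (edges t) (edgesᶠ ts) _)))

edges-tree : ∀ F → edges (tree F) ≡ edgesˢ F
edges-tree ε       = refl
edges-tree (F ▷ G) = begin
  edgesᶠ (⟦ F ⟧ ∷ʳ tree G)                   ≡⟨ edgesᶠ-++ ⟦ F ⟧ _ ⟩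
  edges (tree F) + suc (edges (tree G) + 0)  ≡⟨ cong (λ k → edges (tree F) + suc k) (ℕ.+-identityʳ _) ⟩
  edges (tree F) + suc (edges (tree G))      ≡⟨ ℕ.+-suc _ _ ⟩
  suc (edges (tree F) + edges (tree G))      ≡⟨ cong suc (cong₂ _+_ (edges-tree F) (edges-tree G)) ⟩
  suc (edgesˢ F + edgesˢ G)                  ∎
  where open ≡-Reasoning

leafᶠ : Forest → ℕ
leafᶠ ts = length (filterᵇ isLeaf (preorderᶠ ts))

filterᵇ-++-length : ∀ {A : Set} (p : A → Bool) xs ys →
  length (filterᵇ p (xs ++ ys)) ≡ length (filterᵇ p xs) + length (filterᵇ p ys)
filterᵇ-++-length p []       ys = refl
filterᵇ-++-length p (x ∷ xs) ys with p x
... | true  = cong suc (filterᵇ-++-length p xs ys)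
... | false = filterᵇ-++-length p xs ys

leafᶠ-∷ : ∀ t ts → leafᶠ (t ∷ ts) ≡ leaf t + leafᶠ ts
leafᶠ-∷ (node [])         ts = refl
leafᶠ-∷ (node us@(_ ∷ _)) ts = filterᵇ-++-length isLeaf (preorderᶠ us) (preorderᶠ ts)

leafᶠ-++ : ∀ ts us → leafᶠ (ts ++ us) ≡ leafᶠ ts + leafᶠ us
leafᶠ-++ []       us = refl
leafᶠ-++ (t ∷ ts) us = begin
  leafᶠ (t ∷ ts ++ us)            ≡⟨ leafᶠ-∷ t (ts ++ us) ⟩
  leaf t + leafᶠ (ts ++ us)       ≡⟨ cong (leaf t +_) (leafᶠ-++ ts us) ⟩
  leaf t + (leafᶠ ts + leafᶠ us)  ≡⟨ ℕ.+-assoc (leaf t) _ _ ⟨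
  leaf t + leafᶠ ts + leafᶠ us    ≡⟨ cong (_+ leafᶠ us) (leafᶠ-∷ t ts) ⟨
  leafᶠ (t ∷ ts) + leafᶠ us       ∎
  where open ≡-Reasoning

leaf-∷ʳ : ∀ ts t → leaf (node (ts ∷ʳ t)) ≡ leafᶠ (ts ∷ʳ t)
leaf-∷ʳ []      t = refl
leaf-∷ʳ (_ ∷ _) t = refl

leaf-tree : ∀ F → leaf (tree F) ≡ leafˢ F
leaf-tree ε       = refl
leaf-tree (ε ▷ G) = trans (leafᶠ-∷ (tree G) []) (trans (ℕ.+-identityʳ _) (leaf-tree G))
leaf-tree (F@(F′ ▷ H) ▷ G) = begin
  leaf (tree (F ▷ G))                ≡⟨ leaf-∷ʳ ⟦ F ⟧ (tree G) ⟩
  leafᶠ (⟦ F ⟧ ∷ʳ tree G)            ≡⟨ leafᶠ-++ ⟦ F ⟧ _ ⟩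
  leafᶠ ⟦ F ⟧ + leafᶠ (tree G ∷ [])  ≡⟨ cong₂ _+_ (sym (leaf-∷ʳ ⟦ F′ ⟧ (tree H))) (trans (leafᶠ-∷ (tree G) []) (ℕ.+-identityʳ _)) ⟩
  leaf (tree F) + leaf (tree G)      ≡⟨ cong₂ _+_ (leaf-tree F) (leaf-tree G) ⟩
  leafˢ F + leafˢ G                  ∎
  where open ≡-Reasoning

-- Grafting a path onto the right arm

chain : ℕ → SForest
chain zero    = ε
chain (suc n) = ε ▷ chain n

-- Attaches a path of suc b edges, as rightmost branch, to the node at depth h
-- of the right arm; the value is junk if the right arm has fewer than h edges.
graft : SForest → (h b : ℕ) → SForest
graft F       zero    b = F ▷ chain b
graft ε       (suc h) b = ε
graft (F ▷ G) (suc h) b = F ▷ graft G h b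

-- The node at depth `h` of the right arm has a child, so a branch grafted there gets an older
-- sibling and destroys no leaf.
data Inner : SForest → ℕ → Set where
  here  : ∀ {F G} → Inner (F ▷ G) 0
  there : ∀ {F G h} → Inner G h → Inner (F ▷ G) (suc h)

inner : ∀ F {h} → h < rarmˢ F → Inner F h
inner (F ▷ G) {zero}  _         = here
inner (F ▷ G) {suc h} (s≤s h<r) = there (inner G h<r)

larmˢ-chain : ∀ n → larmˢ (chain n) ≡ n
larmˢ-chain zero    = refl
larmˢ-chain (suc n) = cong suc (larmˢ-chain n)

rarmˢ-chain : ∀ n → rarmˢ (chain n) ≡ n
rarmˢ-chain zero    = refl
rarmˢ-chain (suc n) = cong suc (rarmˢ-chain n)

edgesˢ-chain : ∀ n → edgesˢ (chain n) ≡ n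
edgesˢ-chain zero    = refl
edgesˢ-chain (suc n) = cong suc (edgesˢ-chain n)

leafˢ-chain : ∀ n → leafˢ (chain n) ≡ 1
leafˢ-chain zero    = refl
leafˢ-chain (suc n) = leafˢ-chain n

-- The branch grafted at an inner node is not a leftmost child, so the left arm never enters it.
larmˢ-graft : ∀ {F h} b → Inner F h → larmˢ (graft F h b) ≡ larmˢ F
larmˢ-graft           b here              = refl
larmˢ-graft {ε ▷ G}   b (there i)         = cong suc (larmˢ-graft b i)
larmˢ-graft {_ ▷ _ ▷ G} b (there i)       = refl

rarmˢ-graft : ∀ {F h} b → Inner F h → rarmˢ (graft F h b) ≡ suc (h + b)
rarmˢ-graft b here      = cong suc (rarmˢ-chain b)
rarmˢ-graft b (there i) = cong suc (rarmˢ-graft b i)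

edgesˢ-graft : ∀ {F h} b → Inner F h → edgesˢ (graft F h b) ≡ suc b + edgesˢ F
edgesˢ-graft {F} b here = cong suc (trans (cong (edgesˢ F +_) (edgesˢ-chain b)) (ℕ.+-comm (edgesˢ F) b))
edgesˢ-graft {F ▷ G} {suc h} b (there i) = cong suc (begin
  edgesˢ F + edgesˢ (graft G h b)  ≡⟨ cong (edgesˢ F +_) (edgesˢ-graft b i) ⟩
  edgesˢ F + (suc b + edgesˢ G)    ≡⟨ ℕ.+-assoc (edgesˢ F) (suc b) _ ⟨
  (edgesˢ F + suc b) + edgesˢ G    ≡⟨ cong (_+ edgesˢ G) (ℕ.+-suc (edgesˢ F) b) ⟩
  suc (edgesˢ F + b) + edgesˢ G    ≡⟨ cong (λ k → suc k + edgesˢ G) (ℕ.+-comm (edgesˢ F) b) ⟩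
  suc (b + edgesˢ F) + edgesˢ G    ≡⟨ cong suc (ℕ.+-assoc b _ _) ⟩
  suc (b + (edgesˢ F + edgesˢ G))  ≡⟨ ℕ.+-suc b _ ⟨
  b + suc (edgesˢ F + edgesˢ G)    ∎)
  where open ≡-Reasoning

leafˢ-graft : ∀ {F h} b → Inner F h → leafˢ (graft F h b) ≡ suc (leafˢ F)
leafˢ-graft {F} b here = trans (cong (leafˢ F +_) (leafˢ-chain b)) (ℕ.+-comm (leafˢ F) 1)
leafˢ-graft {ε ▷ G} b (there i) = leafˢ-graft b i
leafˢ-graft {F@(_ ▷ _) ▷ G} b (there i) =
  trans (cong (leafˢ F +_) (leafˢ-graft b i)) (ℕ.+-suc (leafˢ F) _)

-- Codes of trees

-- attach S h b adds a new last leaf to S, at the end of a path of suc b edges;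
-- height is rarm ∸ 1, so that h runs over the inner nodes of the right arm, or
-- over the root alone if S is empty.
data Code : ℕ → Set
height : ∀ {m} → Code m → ℕ

data Code where
  empty  : Code 0
  attach : ∀ {m} (S : Code m) (h b : ℕ) → .(h ≤ height S) → Code (suc m)

height empty            = 0
height (attach S h b _) = h + b

-- The bound is irrelevant, so proofs of it are never compared.
attach-cong : ∀ {m} {S S′ : Code m} {h b} .{p : h ≤ height S} .{q : h ≤ height S′} →
              S ≡ S′ → attach S h b p ≡ attach S′ h b q
attach-cong refl = refl

decode : ∀ {m} → Code m → SForest
decode empty            = ε
decode (attach S h b _) = graft (decode S) h b

-- The counterpart of `_▷_` on codes. The index counts leaves: an empty `c` becomes a leaf of its
-- own, hence `pred k + suc m`.
push : ∀ {m k} → Code m → Code k → Code (pred k + suc m)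
push-height : ∀ {m k} (f : Code m) (c : Code (suc k)) → height (push f c) ≡ suc (height c)

push f empty                           = attach f 0 0 z≤n
-- The first branch of `c` now hangs from the new root, and the edge above it lengthens its path by
-- one.
push f (attach empty _ b _)            = attach f 0 (suc b) z≤n
push f (attach S@(attach _ _ _ _) h b p) =
  attach (push f S) (suc h) b (subst (suc h ≤_) (sym (push-height f S)) (s≤s p))

push-height f (attach empty zero b _)         = refl
push-height f (attach (attach _ _ _ _) h b p) = refl

encode : SForest → ∃ Code
encode ε       = _ , empty
encode (F ▷ G) = _ , push (proj₂ (encode F)) (proj₂ (encode G))

decode-push : ∀ {m k} (f : Code m) (c : Code k) → decode (push f c) ≡ decode f ▷ decode c
decode-push f empty                             = refl
decode-push f (attach empty zero b _)           = refl
decode-push f (attach S@(attach _ _ _ _) h b p) = cong (λ F → graft F (suc h) b) (decode-push f S)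

decode-encode : ∀ F → decode (proj₂ (encode F)) ≡ F
decode-encode ε       = refl
decode-encode (F ▷ G) = trans (decode-push (proj₂ (encode F)) (proj₂ (encode G)))
  (cong₂ _▷_ (decode-encode F) (decode-encode G))

encode-▷ : ∀ F G {k} {c : Code k} → encode G ≡ (k , c) →
           encode (F ▷ G) ≡ (_ , push (proj₂ (encode F)) c)
encode-▷ F G = cong λ (_ , c) → _ , push (proj₂ (encode F)) c

-- Descent along the right arm: the graft acts inside the last child, and `push` turns `attach`
-- there into `attach` one level deeper. At depth 0 a path is hung from the root.
encode-graft : ∀ F h b .(p : h ≤ height (proj₂ (encode F))) →
               encode (graft F h b) ≡ (_ , attach (proj₂ (encode F)) h b p)
encode-graft F zero b p = push-chain b
  where
  encode-chain : ∀ b → encode (chain (suc b)) ≡ (1 , attach empty 0 b z≤n)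
  encode-chain zero    = refl
  encode-chain (suc b) = encode-▷ ε (chain (suc b)) (encode-chain b)

  push-chain : ∀ b → encode (F ▷ chain b) ≡ (_ , attach (proj₂ (encode F)) 0 b p)
  push-chain zero    = refl
  push-chain (suc b) = encode-▷ F (chain (suc b)) (encode-chain b)
encode-graft ε       (suc h) b ()
encode-graft (F ▷ G) (suc h) b p = go (encode G) (encode-graft G h b) p
  where
  -- `encode G` is generalised to a variable pair because `push` computes only once its second
  -- argument is a constructor.
  go : ∀ ((k , c) : ∃ Code) →
       (.(q : h ≤ height c) → encode (graft G h b) ≡ (_ , attach c h b q)) →
       .(p : suc h ≤ height (push (proj₂ (encode F)) c)) →
       encode (F ▷ graft G h b) ≡ (_ , attach (push (proj₂ (encode F)) c) (suc h) b p)
  go (_ , c@(attach S g b′ q)) eq p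
    = encode-▷ F (graft G h b) (eq (ℕ.≤-pred (subst (suc h ≤_) (push-height (proj₂ (encode F)) c) p)))
  go (_ , empty) eq ()

encode-decode : ∀ {m} (c : Code m) → encode (decode c) ≡ (m , c)
encode-decode empty            = refl
encode-decode (attach S h b p) = lemma (encode (decode S)) (encode-decode S) (encode-graft (decode S) h b)
  where
  lemma : ∀ ((k , c) : ∃ Code) → (k , c) ≡ (_ , S) →
          (.(q : h ≤ height c) → encode (graft (decode S) h b) ≡ (_ , attach c h b q)) →
          encode (graft (decode S) h b) ≡ (_ , attach S h b p)
  lemma _ refl eq = eq p

-- Reflecting the depth of the last branch

-- Reflection of the interval [o, K], extended by the identity on [0, o).
reflect : (o K g : ℕ) → ℕ
reflect o K g = if does (g <? o) then g else (o + K) ∸ g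

reflect-≤ : ∀ o {K} g → g ≤ K → reflect o K g ≤ K
reflect-≤ o {K} g g≤K with g <? o
... | yes g<o rewrite dec-true (g <? o) g<o = g≤K
... | no  g≮o rewrite dec-false (g <? o) g≮o = begin
  o + K ∸ g  ≤⟨ ℕ.∸-monoʳ-≤ (o + K) (ℕ.≮⇒≥ g≮o) ⟩
  o + K ∸ o  ≡⟨ ℕ.m+n∸m≡n o K ⟩
  K          ∎
  where open ℕ.≤-Reasoning

-- A reflected point equals `o + (K ∸ g)`, so it is again at least `o` and the second application
-- reflects too.
reflect-involutive : ∀ o {K} g → g ≤ K → reflect o K (reflect o K g) ≡ g
reflect-involutive o {K} g g≤K with g <? o
... | yes g<o rewrite dec-true (g <? o) g<o | dec-true (g <? o) g<o = refl
... | no  g≮o rewrite dec-false (g <? o) g≮o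
                    | dec-false (o + K ∸ g <? o) (ℕ.≤⇒≯ (subst (o ≤_) (sym (ℕ.+-∸-assoc o g≤K)) (ℕ.m≤m+n o (K ∸ g))))
  = ℕ.m∸[m∸n]≡n (ℕ.≤-trans g≤K (ℕ.m≤n+m K o))

bend : ∀ {m} → ℕ → Code m → Code m
bend o empty            = empty
bend o (attach S g b p) = attach S (reflect o (height S) g) b (reflect-≤ o g p)

bend-involutive : ∀ {m} o (c : Code m) → bend o (bend o c) ≡ c
bend-involutive o empty            = refl
bend-involutive o (attach S g b p) = lemma (reflect-involutive o g (recompute (g ≤? height S) p))
  where
  lemma : ∀ {g′} .{p′ : g′ ≤ height S} → g′ ≡ g → attach S g′ b p′ ≡ attach S g b p
  lemma refl = refl

-- Bending may shorten the right arm, but a reflected depth is still at least `h + e`; the next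
-- branch can therefore still be attached at depth `h`.
bend-height : ∀ {m} h e (c : Code m) → h ≤ height c → h ≤ height (bend (h + e) c)
bend-height h e empty            h≤ = h≤
bend-height h e (attach S g b p) h≤ with g <? h + e
... | yes g<o rewrite dec-true  (g <? h + e) g<o = h≤
... | no  g≮o rewrite dec-false (g <? h + e) g≮o = begin
  h                                ≤⟨ ℕ.m≤m+n h e ⟩
  h + e                            ≤⟨ ℕ.m≤m+n (h + e) _ ⟩
  h + e + (height S ∸ g)           ≡⟨ ℕ.+-∸-assoc (h + e) (recompute (g ≤? height S) p) ⟨
  h + e + height S ∸ g             ≤⟨ ℕ.m≤m+n _ b ⟩
  h + e + height S ∸ g + b         ∎
  where open ℕ.≤-Reasoning

-- The bijections onto the gap statistic

carry : ∀ {m} → ℕ → Code m → Code m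
-- Bending is applied only below the last branch, whose own depth and length are kept; this is why
-- the right arm survives.
carry-height : ∀ {m} e (c : Code m) → height (carry e c) ≡ height c

carry e empty            = empty
carry e (attach S h b p) = attach (bend (h + e) (carry e S)) h b
  (bend-height h e (carry e S) (subst (h ≤_) (sym (carry-height e S)) p))

carry-height e empty            = refl
carry-height e (attach S h b p) = refl

carry⁻¹ : ∀ {m} → ℕ → Code m → Code m
carry⁻¹-height : ∀ {m} e (c : Code m) → height (carry⁻¹ e c) ≡ height c

carry⁻¹         e empty            = empty
-- The bent code is not a subterm, so the recursion terminates by the index `m`.
carry⁻¹ {suc m} e (attach S h b p) = attach (carry⁻¹ {m} e (bend (h + e) S)) h b
  (subst (h ≤_) (sym (carry⁻¹-height {m} e (bend (h + e) S))) (bend-height h e S p))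

carry⁻¹-height e empty            = refl
carry⁻¹-height e (attach S h b p) = refl

carry-carry⁻¹ : ∀ {m} e (c : Code m) → carry e (carry⁻¹ e c) ≡ c
carry-carry⁻¹         e empty            = refl
carry-carry⁻¹ {suc m} e (attach S h b p) = attach-cong
  (trans (cong (bend (h + e)) (carry-carry⁻¹ {m} e (bend (h + e) S))) (bend-involutive (h + e) S))

carry⁻¹-carry : ∀ {m} e (c : Code m) → carry⁻¹ e (carry e c) ≡ c
carry⁻¹-carry e empty            = refl
carry⁻¹-carry e (attach S h b p) = attach-cong
  (trans (cong (carry⁻¹ e) (bend-involutive (h + e) (carry e S))) (carry⁻¹-carry e S))

runs : ∀ {m} → Code m → List ℕ
runs empty            = []
runs (attach S h b _) = b ∷ runs S

runs-bend : ∀ {m} o (c : Code m) → runs (bend o c) ≡ runs c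
runs-bend o empty            = refl
runs-bend o (attach S g b p) = refl

runs-carry : ∀ {m} e (c : Code m) → runs (carry e c) ≡ runs c
runs-carry e empty            = refl
runs-carry e (attach S h b p) = cong (b ∷_) (trans (runs-bend (h + e) (carry e S)) (runs-carry e S))

gap : ∀ {m} → Code m → ℕ
gap empty            = 0
gap (attach S h b _) = b + (height S ∸ h)

-- rev ∸ 1 for e = 1 and run ∸ 1 for e = 0.
lastStat : ∀ {m} → ℕ → Code m → ℕ
lastStat e empty                               = 0
lastStat e (attach empty h b _)                = b
lastStat e (attach S@(attach _ g b′ _) h b _)  =
  b + (if does (g <? h + e) then (g + b′) ∸ h else e + lastStat e S)

-- If `g` is below `h + e`, bending keeps it and the first case of `lastStat` results. Otherwise `g`
-- becomes `h + e + (K ∸ g)`, and what the height exceeds `h` by is `e` plus the gap of the carried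
-- smaller code, known by induction.
gap-carry : ∀ {m} e (c : Code m) → gap (carry e c) ≡ lastStat e c
gap-carry e empty                = refl
gap-carry e (attach empty h b _) = trans (cong (b +_) (ℕ.0∸n≡0 h)) (ℕ.+-identityʳ b)
gap-carry e (attach c@(attach S g b′ p) h b q) = cong (b +_) (lemma (g <? h + e) (gap-carry e c))
  where
  -- Carrying `c` yields `attach S′ g b′`, so `K` is the upper end of the interval in which `g` is
  -- reflected.
  S′ = bend (g + e) (carry e S)
  K  = height S′
  open ≡-Reasoning
  g≤K : g ≤ K
  g≤K = recompute (g ≤? K) (bend-height g e (carry e S) (subst (g ≤_) (sym (carry-height e S)) p))
  lemma : _ → gap (carry e c) ≡ lastStat e c → reflect (h + e) K g + b′ ∸ h ≡ (if does (g <? h + e) then (g + b′) ∸ h else e + lastStat e c)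
  lemma (yes g<o) ih rewrite dec-true (g <? h + e) g<o = refl
  lemma (no g≮o) ih rewrite dec-false (g <? h + e) g≮o = begin
    h + e + K ∸ g + b′ ∸ h      ≡⟨ cong (λ k → k + b′ ∸ h) (ℕ.+-∸-assoc (h + e) g≤K) ⟩
    h + e + (K ∸ g) + b′ ∸ h    ≡⟨ cong (_∸ h) (ℕ.+-assoc (h + e) _ b′) ⟩
    h + e + (K ∸ g + b′) ∸ h    ≡⟨ cong (_∸ h) (ℕ.+-assoc h e _) ⟩
    h + (e + (K ∸ g + b′)) ∸ h  ≡⟨ ℕ.m+n∸m≡n h _ ⟩
    e + (K ∸ g + b′)            ≡⟨ cong (e +_) (ℕ.+-comm (K ∸ g) b′) ⟩
    e + gap (carry e c)         ≡⟨ cong (e +_) ih ⟩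
    e + lastStat e c            ∎

-- Statistics of decoded trees

ifPos : ℕ → ℕ → ℕ
-- Index 0 is the single vertex, where the arms, `rev` and `run` vanish; elsewhere they are
-- recovered from their values less one.
ifPos zero    k = 0
ifPos (suc _) k = suc k

total : List ℕ → ℕ
total []       = 0
total (b ∷ bs) = suc b + total bs

-- The path attached first grows from the single vertex and is the left arm; it has one edge more
-- than this entry.
lastRun : List ℕ → ℕ
lastRun []               = 0
lastRun (b ∷ [])         = b
lastRun (_ ∷ bs@(_ ∷ _)) = lastRun bs

-- Mutual with `inner-decode`: the length of a grafted right arm presupposes an inner site, which
-- follows from the arm length of the smaller code.
rarmˢ-decode : ∀ {m} (c : Code m) → rarmˢ (decode c) ≡ ifPos m (height c)
inner-decode : ∀ {m} (c : Code (suc m)) {h} → h ≤ height c → Inner (decode c) h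

rarmˢ-decode empty                         = refl
rarmˢ-decode (attach empty zero b p)       = cong suc (rarmˢ-chain b)
rarmˢ-decode (attach S@(attach _ _ _ _) h b p) =
  rarmˢ-graft b (inner-decode S (recompute (h ≤? height S) p))

inner-decode c {h} h≤ = inner (decode c) (subst (h <_) (sym (rarmˢ-decode c)) (s≤s h≤))

larmˢ-decode : ∀ {m} (c : Code m) → larmˢ (decode c) ≡ ifPos m (lastRun (runs c))
larmˢ-decode empty                   = refl
larmˢ-decode (attach empty zero b p) = cong suc (larmˢ-chain b)
larmˢ-decode (attach S@(attach _ _ _ _) h b p) =
  trans (larmˢ-graft b (inner-decode S (recompute (h ≤? height S) p))) (larmˢ-decode S)

edgesˢ-decode : ∀ {m} (c : Code m) → edgesˢ (decode c) ≡ total (runs c)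
edgesˢ-decode empty                   = refl
edgesˢ-decode (attach empty zero b p) = cong suc (trans (edgesˢ-chain b) (sym (ℕ.+-identityʳ b)))
edgesˢ-decode (attach S@(attach _ _ _ _) h b p) =
  trans (edgesˢ-graft b (inner-decode S (recompute (h ≤? height S) p))) (cong (suc b +_) (edgesˢ-decode S))

-- The first path only moves the leaf of the single vertex; every later one adds a leaf.
leafˢ-decode : ∀ {m} (c : Code m) → leafˢ (decode c) ≡ suc (pred m)
leafˢ-decode empty                   = refl
leafˢ-decode (attach empty zero b p) = leafˢ-chain b
leafˢ-decode (attach S@(attach _ _ _ _) h b p) =
  trans (leafˢ-graft b (inner-decode S (recompute (h ≤? height S) p))) (cong suc (leafˢ-decode S))

-- The recursion common to `rev` and `run`

module LastBranching (e : ℕ) (r : SForest → ℕ)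
  (r-chain : ∀ b → r (chain b) ≡ b)
  -- The last child is not a path here, so the statistic is decided inside it.
  (r-▷ : ∀ F {G h} b → Inner G h → r (F ▷ graft G h b) ≡ r (graft G h b))
  -- The sites where a path may be attached are the root of the single vertex and the inner nodes of
  -- the right arm.
  (r-top : ∀ {F g b′ k} b → F ≡ ε × g ≡ 0 ⊎ Inner F g → r (graft F g b′) ≡ suc k →
           r (graft F g b′ ▷ chain b) ≡
           suc b + (if does (g <? e) then g + b′ else e + k))
  where

  r-graft-chain : ∀ {h n} b → h < n → r (graft (chain n) h b) ≡ suc b + (n ∸ suc h)
  r-graft-chain {zero} {suc n} b _ =
    trans (r-top {ε} {0} b (inj₁ (refl , refl)) (r-chain (suc n))) (cong (suc b +_) (both e))
    where
    -- A path is a graft at depth 0 of the single vertex, and at `g = 0` the two cases agree.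
    both : ∀ e → (if does (0 <? e) then n else e + n) ≡ n
    both zero    = refl
    both (suc _) = refl
  r-graft-chain {suc h} {suc n} b (s≤s h<n) =
    trans (r-▷ ε b (inner (chain n) (subst (h <_) (sym (rarmˢ-chain n)) h<n))) (r-graft-chain b h<n)

  -- While both depths are positive, passing to the last child lowers both by one and leaves their
  -- comparison and difference alone. The descent ends with the new path at the root (`r-top`) or
  -- inside the previous path (`r-graft-chain`).
  r-graft-graft : ∀ F g b′ h b {k} → F ≡ ε × g ≡ 0 ⊎ Inner F g → h ≤ g + b′ → r (graft F g b′) ≡ suc k →
                  r (graft (graft F g b′) h b) ≡
                  suc b + (if does (g <? h + e) then (g + b′) ∸ h else e + k)
  r-graft-graft F g b′ zero b i h≤ eq = r-top b i eq
  r-graft-graft F zero b′ (suc h) b i h<b′ eq =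
    trans (r-▷ F b (inner (chain b′) (subst (h <_) (sym (rarmˢ-chain b′)) h<b′))) (r-graft-chain b h<b′)
  r-graft-graft (F ▷ G) (suc g) b′ (suc h) b (inj₂ (there i)) (s≤s h≤) eq =
    trans (r-▷ F b (inner (graft G g b′) (subst (h <_) (sym (rarmˢ-graft b′ i)) (s≤s h≤))))
          (r-graft-graft G g b′ h b (inj₂ i) h≤ (trans (sym (r-▷ F b′ i)) eq))

  r-decode : ∀ {m} (c : Code m) → r (decode c) ≡ ifPos m (lastStat e c)
  r-decode empty                   = r-chain 0
  r-decode (attach empty zero b p) = r-chain (suc b)
  r-decode (attach S@(attach S′ g b′ q) h b p) =
    r-graft-graft (decode S′) g b′ h b (site S′ (recompute (g ≤? height S′) q)) (recompute (h ≤? g + b′) p) (r-decode S)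
    where
    site : ∀ {m} (c : Code m) {g} → g ≤ height c → decode c ≡ ε × g ≡ 0 ⊎ Inner (decode c) g
    site empty              z≤n = inj₁ (refl , refl)
    site c@(attach _ _ _ _) g≤  = inj₂ (inner-decode c g≤)

-- The recursions for rev and run

-- The number of elements satisfying q from the last element satisfying p
-- onwards, or in the whole list if no element satisfies p.
tally : {A : Set} → (p q : A → Bool) → List A → ℕ
tally p q []       = 0
tally p q (x ∷ xs) =
  if any p xs then tally p q xs
  else if q x then suc (tally p q xs) else tally p q xs

module _ {A : Set} (p : A → Bool) where

  any-++-hit : ∀ xs ys → any p ys ≡ true → any p (xs ++ ys) ≡ true
  any-++-hit []       ys hit = hit
  any-++-hit (x ∷ xs) ys hit = trans (cong (p x ∨_) (any-++-hit xs ys hit)) (∨-zeroʳ (p x))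

  any-++-miss : ∀ xs ys → any p ys ≡ false → any p (xs ++ ys) ≡ any p xs
  any-++-miss []       ys miss = miss
  any-++-miss (x ∷ xs) ys miss = cong (p x ∨_) (any-++-miss xs ys miss)

  module _ (q : A → Bool) where

    tally-++-hit : ∀ xs ys → any p ys ≡ true → tally p q (xs ++ ys) ≡ tally p q ys
    tally-++-hit []       ys hit = refl
    tally-++-hit (x ∷ xs) ys hit rewrite any-++-hit xs ys hit = tally-++-hit xs ys hit

    tally-++-miss : ∀ xs ys → any p ys ≡ false →
                    tally p q (xs ++ ys) ≡ tally p q xs + tally p q ys
    tally-++-miss []       ys miss = refl
    tally-++-miss (x ∷ xs) ys miss rewrite any-++-miss xs ys miss with any p xs | q x
    ... | true  | _     = tally-++-miss xs ys miss
    ... | false | true  = cong suc (tally-++-miss xs ys miss)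
    ... | false | false = tally-++-miss xs ys miss

    tally-none : ∀ xs → any p xs ≡ false → tally p q xs ≡ length (filterᵇ q xs)
    tally-none []       none = refl
    tally-none (x ∷ xs) none with p x | any p xs in eq
    ... | false | false with q x
    ...   | true  = cong suc (tally-none xs eq)
    ...   | false = tally-none xs eq

    tally-fromLastᵇ : ∀ xs → any p xs ≡ true → length (filterᵇ q (fromLastᵇ p xs)) ≡ tally p q xs
    tally-fromLastᵇ (x ∷ xs) some with any p xs in eq
    ... | true = tally-fromLastᵇ xs eq
    ... | false with p x
    ...   | true with q x
    ...     | true  = cong suc (sym (tally-none xs eq))
    ...     | false = sym (tally-none xs eq)

  -- The accumulator `ys` makes the induction along `reverse` possible; the scan reaches it only if
  -- nothing in `xs` satisfies `p`.
  tally-takeWhileᵇ : ∀ xs ys → length (takeWhileᵇ (not ∘ p) (xs ʳ++ ys)) ≡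
    tally p (not ∘ p) xs + (if any p xs then 0 else length (takeWhileᵇ (not ∘ p) ys))
  tally-takeWhileᵇ []       ys = refl
  tally-takeWhileᵇ (x ∷ xs) ys rewrite tally-takeWhileᵇ xs (x ∷ ys) with any p xs | p x
  ... | true  | true  = refl
  ... | true  | false = refl
  ... | false | true  = refl
  ... | false | false = ℕ.+-suc _ _

module _ {A B : Set} (f : A → B) (p q : B → Bool) where

  any-map : ∀ xs → any (p ∘ f) xs ≡ any p (map f xs)
  any-map []       = refl
  any-map (x ∷ xs) = cong (p (f x) ∨_) (any-map xs)

  tally-map : ∀ xs → tally (p ∘ f) (q ∘ f) xs ≡ tally p q (map f xs)
  tally-map []       = refl
  tally-map (x ∷ xs) rewrite any-map xs | tally-map xs = refl

isInternal : Node → Bool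
isInternal = not ∘ isLeaf

isYoungest : Node → Bool
isYoungest = not ∘ hasYounger

any-isBranching : ∀ T → any isBranching (preorder T) ≡ not (isPath T)
any-isBranching (node [])          = refl
any-isBranching (node (t ∷ []))    = trans (cong (any isBranching) (++-identityʳ (preorder t))) (any-isBranching t)
any-isBranching (node (_ ∷ _ ∷ _)) = refl

any-hasYounger : ∀ ts → any hasYounger (preorderᶠ ts) ≡ not (isPath (node ts))
any-hasYounger []                = refl
any-hasYounger (node us ∷ [])    = trans (cong (any hasYounger) (++-identityʳ (preorderᶠ us))) (any-hasYounger us)
any-hasYounger (node _ ∷ _ ∷ _)  = refl

tally-hasYounger : ∀ ts → isPath (node ts) ≡ true →
                   tally hasYounger isYoungest (preorderᶠ ts) ≡ edgesᶠ ts
tally-hasYounger []             path = refl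
tally-hasYounger (node us ∷ []) path
  rewrite ++-identityʳ (preorderᶠ us) | any-hasYounger us | path
        | ℕ.+-identityʳ (edgesᶠ us) = cong suc (tally-hasYounger us path)

tally-isBranching : ∀ T → isPath T ≡ true → tally isBranching isInternal (preorder T) ≡ edges T
tally-isBranching (node [])       path = refl
tally-isBranching (node (t ∷ [])) path
  rewrite ++-identityʳ (preorder t) | any-isBranching t | path
        | ℕ.+-identityʳ (edges t) = cong suc (tally-isBranching t path)

-- Omitting the root absorbs the convention for paths: a path has as many other nodes as edges, and
-- in any other tree the root precedes a node with a younger sibling and is not counted anyway.
rev-tally : ∀ ts → rev (node ts) ≡ tally hasYounger isYoungest (preorderᶠ ts)
rev-tally ts with isPath (node ts) in eq
... | true  = sym (tally-hasYounger ts eq)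
... | false = begin
  length (takeWhileᵇ isYoungest (reverse (preorder (node ts))))        ≡⟨ tally-takeWhileᵇ hasYounger (preorder (node ts)) [] ⟩
  tally hasYounger isYoungest (preorder (node ts)) + (if some then 0 else 0)
                                                                       ≡⟨ cong₂ _+_ (root (trans (any-hasYounger ts) (cong not eq))) (if-eta some) ⟩
  tally hasYounger isYoungest (preorderᶠ ts) + 0                       ≡⟨ ℕ.+-identityʳ _ ⟩
  tally hasYounger isYoungest (preorderᶠ ts)                           ∎
  where
  open ≡-Reasoning
  some = any hasYounger (preorderᶠ ts)
  root : some ≡ true → tally hasYounger isYoungest (preorder (node ts)) ≡ tally hasYounger isYoungest (preorderᶠ ts)
  root = tally-++-hit hasYounger isYoungest (mkNode (node ts) [] ∷ []) (preorderᶠ ts)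

-- A path has as many internal nodes as edges, so its conventional value is the tally of a list
-- without branching nodes.
run-tally : ∀ T → run T ≡ tally isBranching isInternal (preorder T)
run-tally T with isPath T in eq
... | true  = sym (tally-isBranching T eq)
... | false = tally-fromLastᵇ isBranching isInternal (preorder T)
                (trans (any-isBranching T) (cong not eq))

-- The nodes of ts, in preorder, when ts is followed by us.
preorderBefore : Forest → Forest → List Node
preorderBefore []       us = []
preorderBefore (t ∷ ts) us = preorderFrom t (ts ++ us) ++ preorderBefore ts us

preorderᶠ-++ : ∀ ts us → preorderᶠ (ts ++ us) ≡ preorderBefore ts us ++ preorderᶠ us
preorderᶠ-++ []       us = refl
preorderᶠ-++ (t ∷ ts) us = trans (cong (preorderFrom t (ts ++ us) ++_) (preorderᶠ-++ ts us))
  (sym (++-assoc (preorderFrom t (ts ++ us)) _ _))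

preorderBefore-∷ʳ : ∀ ts t us → preorderBefore (ts ∷ʳ t) us ≡
                    preorderBefore ts (t ∷ us) ++ preorderFrom t us
preorderBefore-∷ʳ []       t us = ++-identityʳ _
preorderBefore-∷ʳ (u ∷ ts) t us = trans
  (cong₂ (λ vs ns → preorderFrom u vs ++ ns) (++-assoc ts _ us) (preorderBefore-∷ʳ ts t us))
  (sym (++-assoc (preorderFrom u (ts ++ t ∷ us)) _ _))

-- Trees appended on the right alter only the lists of younger siblings.
subtrees-preorderBefore : ∀ ts us →
  map Node.subtree (preorderBefore ts us) ≡ map Node.subtree (preorderᶠ ts)
subtrees-preorderBefore []             us = refl
subtrees-preorderBefore (node vs ∷ ts) us = cong (node vs ∷_) (begin
  map Node.subtree (preorderᶠ vs ++ preorderBefore ts us)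
    ≡⟨ map-++ Node.subtree (preorderᶠ vs) _ ⟩
  map Node.subtree (preorderᶠ vs) ++ map Node.subtree (preorderBefore ts us)
    ≡⟨ cong (map Node.subtree (preorderᶠ vs) ++_) (subtrees-preorderBefore ts us) ⟩
  map Node.subtree (preorderᶠ vs) ++ map Node.subtree (preorderᶠ ts)
    ≡⟨ map-++ Node.subtree (preorderᶠ vs) _ ⟨
  map Node.subtree (preorderᶠ vs ++ preorderᶠ ts) ∎)
  where open ≡-Reasoning

isPath-▷▷ : ∀ F G H → isPath (tree (F ▷ G ▷ H)) ≡ false
isPath-▷▷ F G H = two ⟦ F ⟧
  where
  two : ∀ ts {t u} → isPath (node ((ts ∷ʳ t) ∷ʳ u)) ≡ false
  two []          = refl
  two (_ ∷ [])    = refl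
  two (_ ∷ _ ∷ _) = refl

isPath-chain : ∀ b → isPath (tree (chain b)) ≡ true
isPath-chain zero    = refl
isPath-chain (suc b) = isPath-chain b

isPath-graft : ∀ {F h} b → Inner F h → isPath (tree (graft F h b)) ≡ false
isPath-graft           b (here {F} {G})        = isPath-▷▷ F G (chain b)
isPath-graft {ε ▷ G}   b (there i)             = isPath-graft b i
isPath-graft {F ▷ G ▷ H} {suc h} b (there i)   = isPath-▷▷ F G (graft H h b)

edges-chain : ∀ b → edges (tree (chain b)) ≡ b
edges-chain b = trans (edges-tree (chain b)) (edgesˢ-chain b)

rev-chain : ∀ b → rev (tree (chain b)) ≡ b
rev-chain b rewrite isPath-chain b = edges-chain b

run-chain : ∀ b → run (tree (chain b)) ≡ b
run-chain b rewrite isPath-chain b = edges-chain b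

-- The last child is not a path, so the last node with a younger sibling lies below its root.
rev-▷ : ∀ F {G h} b → Inner G h → rev (tree (F ▷ graft G h b)) ≡ rev (tree (graft G h b))
rev-▷ F {G} {h} b i = begin
  rev (tree (F ▷ H))                    ≡⟨ rev-tally ⟦ F ▷ H ⟧ ⟩
  τ (preorderᶠ ⟦ F ▷ H ⟧)               ≡⟨ cong τ (preorderᶠ-++ ⟦ F ⟧ _) ⟩
  τ (before ++ mkNode (tree H) [] ∷ (preorderᶠ ⟦ H ⟧ ++ []))
                                        ≡⟨ cong (λ ns → τ (before ++ mkNode (tree H) [] ∷ ns)) (++-identityʳ _) ⟩
  τ (before ++ mkNode (tree H) [] ∷ preorderᶠ ⟦ H ⟧)
                                        ≡⟨ cong τ (++-assoc before (mkNode (tree H) [] ∷ []) _) ⟨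
  τ ((before ∷ʳ mkNode (tree H) []) ++ preorderᶠ ⟦ H ⟧)
                                        ≡⟨ tally-++-hit hasYounger isYoungest (before ∷ʳ _) (preorderᶠ ⟦ H ⟧) hit ⟩
  τ (preorderᶠ ⟦ H ⟧)                   ≡⟨ rev-tally ⟦ H ⟧ ⟨
  rev (tree H)                          ∎
  where
  open ≡-Reasoning
  τ      = tally hasYounger isYoungest
  H      = graft G h b
  before = preorderBefore ⟦ F ⟧ (tree H ∷ [])
  hit : any hasYounger (preorderᶠ ⟦ H ⟧) ≡ true
  hit = trans (any-hasYounger ⟦ H ⟧) (cong not (isPath-graft b i))

-- The root of `tree G` has the new path as younger sibling, which stops the count there; below it
-- `rev (tree G)` nodes are counted, and the path adds `suc b`.
rev-▷▷chain : ∀ F G b → rev (tree (F ▷ G ▷ chain b)) ≡ suc b + rev (tree G)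
rev-▷▷chain F G b = begin
  rev (tree (F ▷ G ▷ chain b))                  ≡⟨ rev-tally ⟦ F ▷ G ▷ chain b ⟧ ⟩
  τ (preorderᶠ (⟦ F ▷ G ⟧ ++ us))               ≡⟨ cong τ (preorderᶠ-++ ⟦ F ▷ G ⟧ us) ⟩
  τ (preorderBefore ⟦ F ▷ G ⟧ us ++ preorderᶠ us)
    ≡⟨ tally-++-miss hasYounger isYoungest (preorderBefore ⟦ F ▷ G ⟧ us) (preorderᶠ us)
         (trans (any-hasYounger us) (cong not (isPath-chain b))) ⟩
  τ (preorderBefore ⟦ F ▷ G ⟧ us) + τ (preorderᶠ us)
    ≡⟨ cong₂ _+_ (trans (cong τ (preorderBefore-∷ʳ ⟦ F ⟧ (tree G) us))
                        (tally-++-hit hasYounger isYoungest (preorderBefore ⟦ F ⟧ (tree G ∷ us)) (preorderFrom (tree G) us) refl))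
                 (tally-hasYounger us (isPath-chain b)) ⟩
  τ (preorderFrom (tree G) us) + edgesᶠ us
    -- Having a younger sibling, the root of `tree G` is not counted in either branch.
    ≡⟨ cong₂ _+_ (trans (if-eta (any hasYounger (preorderᶠ ⟦ G ⟧))) (sym (rev-tally ⟦ G ⟧)))
                 (cong suc (trans (ℕ.+-identityʳ _) (edges-chain b))) ⟩
  rev (tree G) + suc b                          ≡⟨ ℕ.+-comm _ (suc b) ⟩
  suc b + rev (tree G)                          ∎
  where
  open ≡-Reasoning
  τ  = tally hasYounger isYoungest
  us = tree (chain b) ∷ []

run-▷ : ∀ F {G h} b → Inner G h → run (tree (F ▷ graft G h b)) ≡ run (tree (graft G h b))
run-▷ F {G} {h} b i = begin
  run (tree (F ▷ H))                        ≡⟨ run-tally (tree (F ▷ H)) ⟩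
  τ (root ∷ preorderᶠ ⟦ F ▷ H ⟧)            ≡⟨ cong (τ ∘ (root ∷_)) (preorderᶠ-++ ⟦ F ⟧ _) ⟩
  τ (root ∷ before ++ (preorder (tree H) ++ []))
                                            ≡⟨ cong (λ ns → τ (root ∷ before ++ ns)) (++-identityʳ (preorder (tree H))) ⟩
  τ (root ∷ before ++ preorder (tree H))    ≡⟨ tally-++-hit isBranching isInternal (root ∷ before) (preorder (tree H)) hit ⟩
  τ (preorder (tree H))                     ≡⟨ run-tally (tree H) ⟨
  run (tree H)                              ∎
  where
  open ≡-Reasoning
  τ      = tally isBranching isInternal
  H      = graft G h b
  root   = mkNode (tree (F ▷ H)) []
  before = preorderBefore ⟦ F ⟧ (tree H ∷ [])
  hit : any isBranching (preorder (tree H)) ≡ true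
  hit = trans (any-isBranching (tree H)) (cong not (isPath-graft b i))

null-∷ʳ : ∀ {A : Set} (xs : List A) {x} → null (xs ∷ʳ x) ≡ false
null-∷ʳ []      = refl
null-∷ʳ (_ ∷ _) = refl

-- The new path has `b` internal nodes and no branching one. Deleting it leaves the root internal
-- and changes at most whether the root branches, which `tally` does not test at the head of a list.
run-▷▷chain : ∀ F G b → run (tree (F ▷ G ▷ chain b)) ≡ b + run (tree (F ▷ G))
run-▷▷chain F G b = begin
  run (tree (F ▷ G ▷ chain b))                ≡⟨ run-tally (tree (F ▷ G ▷ chain b)) ⟩
  τ (root ∷ preorderᶠ (ts ++ us))             ≡⟨ cong (τ ∘ (root ∷_)) (preorderᶠ-++ ts us) ⟩
  τ (root ∷ preorderBefore ts us ++ (preorder (tree (chain b)) ++ []))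
                                              ≡⟨ cong (λ ns → τ (root ∷ preorderBefore ts us ++ ns)) (++-identityʳ (preorder (tree (chain b)))) ⟩
  τ (root ∷ preorderBefore ts us ++ preorder (tree (chain b)))
    ≡⟨ tally-++-miss isBranching isInternal (root ∷ preorderBefore ts us) (preorder (tree (chain b)))
         (trans (any-isBranching (tree (chain b))) (cong not (isPath-chain b))) ⟩
  τ (root ∷ preorderBefore ts us) + τ (preorder (tree (chain b)))
    ≡⟨ cong₂ _+_ prune (trans (sym (run-tally (tree (chain b)))) (run-chain b)) ⟩
  τ (preorder (tree (F ▷ G))) + b             ≡⟨ cong (_+ b) (run-tally (tree (F ▷ G))) ⟨
  run (tree (F ▷ G)) + b                      ≡⟨ ℕ.+-comm _ b ⟩
  b + run (tree (F ▷ G))                      ∎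
  where
  open ≡-Reasoning
  τ    = tally isBranching isInternal
  ts   = ⟦ F ▷ G ⟧
  us   = tree (chain b) ∷ []
  root = mkNode (node (ts ++ us)) []
  p q : Tree → Bool
  p T = 2 ≤ᵇ length (children T)
  q T = not (null (children T))
  internal : ∀ T U ss → q T ≡ q U → tally p q (T ∷ ss) ≡ tally p q (U ∷ ss)
  internal T U ss eq rewrite eq = refl
  prune : τ (root ∷ preorderBefore ts us) ≡ τ (preorder (node ts))
  prune = begin
    τ (root ∷ preorderBefore ts us)                                        ≡⟨ tally-map Node.subtree p q (root ∷ preorderBefore ts us) ⟩
    tally p q (node (ts ++ us) ∷ map Node.subtree (preorderBefore ts us))  ≡⟨ cong (tally p q ∘ (node (ts ++ us) ∷_)) (subtrees-preorderBefore ts us) ⟩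
    tally p q (node (ts ++ us) ∷ map Node.subtree (preorderᶠ ts))          ≡⟨ internal (node (ts ++ us)) (node ts) (map Node.subtree (preorderᶠ ts)) (cong not (trans (null-∷ʳ ts) (sym (null-∷ʳ ⟦ F ⟧)))) ⟩
    tally p q (map Node.subtree (preorder (node ts)))                      ≡⟨ tally-map Node.subtree p q (preorder (node ts)) ⟨
    τ (preorder (node ts))                                                 ∎

rev-top : ∀ {F g b′ k} b → F ≡ ε × g ≡ 0 ⊎ Inner F g → rev (tree (graft F g b′)) ≡ suc k →
          rev (tree (graft F g b′ ▷ chain b)) ≡
          suc b + (if does (g <? 1) then g + b′ else 1 + k)
rev-top {F} {zero} {b′} b i eq = trans (rev-▷▷chain F (chain b′) b) (cong (suc b +_) (rev-chain b′))
rev-top {F ▷ G} {suc g} {b′} b (inj₂ (there i)) eq =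
  trans (rev-▷▷chain F (graft G g b′) b) (cong (suc b +_) (trans (sym (rev-▷ F b′ i)) eq))

-- The cases on `g` only expose the outermost `▷` of the graft.
run-top : ∀ {F g b′ k} b → F ≡ ε × g ≡ 0 ⊎ Inner F g → run (tree (graft F g b′)) ≡ suc k →
          run (tree (graft F g b′ ▷ chain b)) ≡
          suc b + (if does (g <? 0) then g + b′ else 0 + k)
run-top {F} {zero} {b′} {k} b i eq =
  trans (run-▷▷chain F (chain b′) b) (trans (cong (b +_) eq) (ℕ.+-suc b k))
run-top {F ▷ G} {suc g} {b′} {k} b i eq =
  trans (run-▷▷chain F (graft G g b′) b) (trans (cong (b +_) eq) (ℕ.+-suc b k))

rev-decode : ∀ {m} (c : Code m) → rev (tree (decode c)) ≡ ifPos m (lastStat 1 c)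
rev-decode = LastBranching.r-decode 1 (rev ∘ tree) rev-chain rev-▷ rev-top

run-decode : ∀ {m} (c : Code m) → run (tree (decode c)) ≡ ifPos m (lastStat 0 c)
run-decode = LastBranching.r-decode 0 (run ∘ tree) run-chain run-▷ run-top

-- Rerooting at the last leaf

consˢ : SForest → SForest → SForest
consˢ X ε       = ε ▷ X
consˢ X (F ▷ G) = consˢ X F ▷ G

mirror : SForest → SForest
mirror ε       = ε
mirror (F ▷ G) = consˢ (mirror G) (mirror F)

mirror-consˢ : ∀ X F → mirror (consˢ X F) ≡ mirror F ▷ mirror X
mirror-consˢ X ε       = refl
mirror-consˢ X (F ▷ G) = cong (consˢ (mirror G)) (mirror-consˢ X F)

mirror-involutive : ∀ F → mirror (mirror F) ≡ F
mirror-involutive ε       = refl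
mirror-involutive (F ▷ G) = trans (mirror-consˢ (mirror G) (mirror F))
  (cong₂ _▷_ (mirror-involutive F) (mirror-involutive G))

larmˢ-consˢ : ∀ X F → larmˢ (consˢ X F) ≡ suc (larmˢ X)
larmˢ-consˢ X ε           = refl
larmˢ-consˢ X (ε ▷ G)     = refl
larmˢ-consˢ X (F ▷ H ▷ G) = larmˢ-consˢ X (F ▷ H)

larmˢ-mirror : ∀ F → larmˢ (mirror F) ≡ rarmˢ F
larmˢ-mirror ε       = refl
larmˢ-mirror (F ▷ G) = trans (larmˢ-consˢ (mirror G) (mirror F)) (cong suc (larmˢ-mirror G))

edgesˢ-consˢ : ∀ X F → edgesˢ (consˢ X F) ≡ suc (edgesˢ F + edgesˢ X)
edgesˢ-consˢ X ε       = refl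
edgesˢ-consˢ X (F ▷ G) = cong suc (begin
  edgesˢ (consˢ X F) + edgesˢ G           ≡⟨ cong (_+ edgesˢ G) (edgesˢ-consˢ X F) ⟩
  suc (edgesˢ F + edgesˢ X + edgesˢ G)    ≡⟨ cong suc (ℕ.+-assoc (edgesˢ F) _ _) ⟩
  suc (edgesˢ F + (edgesˢ X + edgesˢ G))  ≡⟨ cong (λ k → suc (edgesˢ F + k)) (ℕ.+-comm (edgesˢ X) _) ⟩
  suc (edgesˢ F + (edgesˢ G + edgesˢ X))  ≡⟨ cong suc (ℕ.+-assoc (edgesˢ F) _ _) ⟨
  suc (edgesˢ F + edgesˢ G + edgesˢ X)    ∎)
  where open ≡-Reasoning

edgesˢ-mirror : ∀ F → edgesˢ (mirror F) ≡ edgesˢ F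
edgesˢ-mirror ε       = refl
edgesˢ-mirror (F ▷ G) = trans (edgesˢ-consˢ (mirror G) (mirror F))
  (cong suc (cong₂ _+_ (edgesˢ-mirror F) (edgesˢ-mirror G)))

-- A zipper descending the right arm. `A` holds the part above, already turned over: seen from
-- below, the parent becomes the last child and the mirrored older siblings precede it. The initial
-- `ε` is the planted vertex, which ends as the last leaf.
rerootOnto : SForest → SForest → SForest
rerootOnto ε       A = A
rerootOnto (F ▷ G) A = rerootOnto G (mirror F ▷ A)

reroot : SForest → SForest
reroot F = rerootOnto F ε

_⊕_ : SForest → SForest → SForest
ε       ⊕ A = A
(F ▷ G) ⊕ A = F ▷ (G ⊕ A)

⊕-identityʳ : ∀ F → F ⊕ ε ≡ F
⊕-identityʳ ε       = refl
⊕-identityʳ (F ▷ G) = cong (F ▷_) (⊕-identityʳ G)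

-- Along right arms this is the list law `(xs ʳ++ ys) ʳ++ zs = ys ʳ++ (xs ++ zs)`; the sibling
-- forests of `F` are mirrored twice.
rerootOnto-rerootOnto : ∀ F A B → rerootOnto (rerootOnto F A) B ≡ rerootOnto A (F ⊕ B)
rerootOnto-rerootOnto ε       A B = refl
rerootOnto-rerootOnto (F ▷ G) A B = trans (rerootOnto-rerootOnto G (mirror F ▷ A) B)
  (cong (λ X → rerootOnto A (X ▷ (G ⊕ B))) (mirror-involutive F))

reroot-involutive : ∀ F → reroot (reroot F) ≡ F
reroot-involutive F = trans (rerootOnto-rerootOnto F ε ε) (⊕-identityʳ F)

rarmˢ-rerootOnto : ∀ F A → rarmˢ (rerootOnto F A) ≡ rarmˢ F + rarmˢ A
rarmˢ-rerootOnto ε       A = refl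
rarmˢ-rerootOnto (F ▷ G) A = trans (rarmˢ-rerootOnto G _) (ℕ.+-suc (rarmˢ G) (rarmˢ A))

edgesˢ-rerootOnto : ∀ F A → edgesˢ (rerootOnto F A) ≡ edgesˢ F + edgesˢ A
edgesˢ-rerootOnto ε       A = refl
edgesˢ-rerootOnto (F ▷ G) A = begin
  edgesˢ (rerootOnto G (mirror F ▷ A))             ≡⟨ edgesˢ-rerootOnto G _ ⟩
  edgesˢ G + suc (edgesˢ (mirror F) + edgesˢ A)    ≡⟨ ℕ.+-suc (edgesˢ G) _ ⟩
  suc (edgesˢ G + (edgesˢ (mirror F) + edgesˢ A))  ≡⟨ cong suc (ℕ.+-assoc (edgesˢ G) _ _) ⟨
  suc (edgesˢ G + edgesˢ (mirror F) + edgesˢ A)    ≡⟨ cong (λ k → suc (k + edgesˢ A)) (ℕ.+-comm (edgesˢ G) _) ⟩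
  suc (edgesˢ (mirror F) + edgesˢ G + edgesˢ A)    ≡⟨ cong (λ k → suc (k + edgesˢ G + edgesˢ A)) (edgesˢ-mirror F) ⟩
  suc (edgesˢ F + edgesˢ G + edgesˢ A)             ∎
  where open ≡-Reasoning

larmˢ-rerootOnto-chain : ∀ b A → larmˢ (rerootOnto (chain b) A) ≡ b + larmˢ A
larmˢ-rerootOnto-chain zero    A = refl
larmˢ-rerootOnto-chain (suc b) A = trans (larmˢ-rerootOnto-chain b (ε ▷ A)) (ℕ.+-suc b (larmˢ A))

-- The new left arm climbs the grafted path to its branch node and then follows the former right arm
-- of `F` downwards; `A` stays to its right.
larmˢ-rerootOnto-graft : ∀ {F h} b A → Inner F h →
  larmˢ (rerootOnto (graft F h b) A) ≡ suc b + (rarmˢ F ∸ suc h)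
larmˢ-rerootOnto-graft b A (here {F} {G}) = begin
  larmˢ (rerootOnto (chain b) (mirror (F ▷ G) ▷ A))  ≡⟨ larmˢ-rerootOnto-chain b _ ⟩
  b + larmˢ (consˢ (mirror G) (mirror F) ▷ A)        ≡⟨ cong (b +_) (larmˢ-consˢ (mirror G) (mirror F ▷ A)) ⟩
  b + suc (larmˢ (mirror G))                         ≡⟨ cong (λ k → b + suc k) (larmˢ-mirror G) ⟩
  b + suc (rarmˢ G)                                  ≡⟨ ℕ.+-suc b _ ⟩
  suc b + rarmˢ G                                    ∎
  where open ≡-Reasoning
larmˢ-rerootOnto-graft {F ▷ _} b A (there i) = larmˢ-rerootOnto-graft b (mirror F ▷ A) i

larmˢ-reroot-decode : ∀ {m} (c : Code m) → larmˢ (reroot (decode c)) ≡ ifPos m (gap c)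
larmˢ-reroot-decode empty                   = refl
larmˢ-reroot-decode (attach empty zero b p) = trans (larmˢ-rerootOnto-chain b (ε ▷ ε)) (ℕ.+-suc b 0)
larmˢ-reroot-decode (attach S@(attach _ _ _ _) h b p) =
  trans (larmˢ-rerootOnto-graft b ε (inner-decode S (recompute (h ≤? height S) p)))
          (cong (λ r → suc b + (r ∸ suc h)) (rarmˢ-decode S))

-- Exchanging the right arm and the gap

turn : ∀ {m} → Code m → Code m
turn empty            = empty
turn (attach S h b _) = attach S (height S ∸ h) b (ℕ.m∸n≤m (height S) h)

turn-involutive : ∀ {m} (c : Code m) → turn (turn c) ≡ c
turn-involutive empty            = refl
turn-involutive (attach S h b p) = lemma (ℕ.m∸[m∸n]≡n (recompute (h ≤? height S) p))
  where
  lemma : ∀ {h′} .{p′ : h′ ≤ height S} → h′ ≡ h → attach S h′ b p′ ≡ attach S h b p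
  lemma refl = refl

runs-turn : ∀ {m} (c : Code m) → runs (turn c) ≡ runs c
runs-turn empty            = refl
runs-turn (attach S h b p) = refl

gap-turn : ∀ {m} (c : Code m) → gap (turn c) ≡ height c
gap-turn empty            = refl
gap-turn (attach S h b p) = trans (cong (b +_) (ℕ.m∸[m∸n]≡n (recompute (h ≤? height S) p))) (ℕ.+-comm b h)

height-turn : ∀ {m} (c : Code m) → height (turn c) ≡ gap c
height-turn empty            = refl
height-turn (attach S h b p) = ℕ.+-comm (height S ∸ h) b

-- Transporting bijections to trees

SForest↔Code : SForest ↔ ∃ Code
SForest↔Code = mk↔ₛ′ encode (decode ∘ proj₂) (encode-decode ∘ proj₂) decode-encode

Tree↔SForest : Tree ↔ SForest
Tree↔SForest = mk↔ₛ′ (λ { (node ts) → unloadOnto ε ts }) tree unloadOnto-⟦⟧ (λ { (node ts) → cong node (⟦unloadOnto⟧ ε ts) })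

carry↔ : ∀ {m} → ℕ → Code m ↔ Code m
carry↔ e = mk↔ₛ′ (carry e) (carry⁻¹ e) (carry-carry⁻¹ e) (carry⁻¹-carry e)

turn↔ : ∀ {m} → Code m ↔ Code m
turn↔ = mk↔ₛ′ turn turn turn-involutive turn-involutive

onCode : (∀ {m} → Code m ↔ Code m) → SForest ↔ SForest
onCode f = ↔-sym SForest↔Code ↔-∘ (fibrewise ↔-∘ SForest↔Code)
  where
  fibrewise : ∃ Code ↔ ∃ Code
  fibrewise = mk↔ₛ′ (λ (m , c) → m , Inverse.to f c) (λ (m , c) → m , Inverse.from f c)
    (λ (m , c) → cong (m ,_) (Inverse.strictlyInverseˡ f c))
    (λ (m , c) → cong (m ,_) (Inverse.strictlyInverseʳ f c))

onSForest : SForest ↔ SForest → Tree ↔ Tree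
onSForest f = ↔-sym Tree↔SForest ↔-∘ (f ↔-∘ Tree↔SForest)

restrict : (f : Tree ↔ Tree) → (∀ T → edges (Inverse.to f T) ≡ edges T) → ∀ n → 𝒫 n ↔ 𝒫 n
restrict f pres n = mk↔ₛ′
  (λ (T , eq) → to T , trans (pres T) eq)
  (λ (T , eq) → from T , trans (trans (sym (pres (from T))) (cong edges (strictlyInverseˡ T))) eq)
  (λ (T , _) → ext (strictlyInverseˡ T))
  (λ (T , _) → ext (strictlyInverseʳ T))
  where
  open Inverse f
  ext : ∀ {T U : 𝒫 n} → proj₁ T ≡ proj₁ U → T ≡ U
  ext {T , p} {U , q} refl = cong (T ,_) (ℕ.≡-irrelevant p q)

-- Permuting the three exponents

legs : SForest → Exponents 3
-- The third entry is the gap, written through `reroot` so that its exchange with the first is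
-- immediate.
legs F = larmˢ F ∸ 1 ∷ rarmˢ F ∸ 1 ∷ larmˢ (reroot F) ∸ 1 ∷ []

exponents : Tree → Exponents 3
exponents T = larm T ∸ 1 ∷ rarm T ∸ 1 ∷ rev T ∸ 1 ∷ []

permute : (Fin 3 → Fin 3) → Exponents 3 → Exponents 3
permute π v = tabulate λ j → lookup v (π j)

permute-∘ : ∀ π ρ v → permute ρ (permute π v) ≡ permute (π ∘ ρ) v
permute-∘ π ρ v = tabulate-cong λ j → lookup∘tabulate (λ j → lookup v (π j)) (ρ j)

record Realised (π : Fin 3 → Fin 3) : Set where
  constructor realise
  field
    bijection     : SForest ↔ SForest
    edges-fixed   : ∀ F → edgesˢ (Inverse.to bijection F) ≡ edgesˢ F
    legs-permuted : ∀ F → legs (Inverse.to bijection F) ≡ permute π (legs F)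

realised-cong : ∀ {π ρ} → (∀ j → π j ≡ ρ j) → Realised π → Realised ρ
realised-cong eq (realise f p q) = realise f p λ F →
  trans (q F) (tabulate-cong (cong (lookup (legs F)) ∘ eq))

realised-id : Realised id
realised-id = realise (↔-id _) (λ _ → refl) (λ _ → refl)

realised-∘ : ∀ {π ρ} → Realised π → Realised ρ → Realised (π ∘ ρ)
realised-∘ {π} {ρ} (realise f p p′) (realise g q q′) = realise (g ↔-∘ f)
  (λ F → trans (q (Inverse.to f F)) (p F))
  (λ F → trans (q′ (Inverse.to f F))
    (trans (cong (permute ρ) (p′ F)) (permute-∘ π ρ (legs F))))

realised-02 : Realised (transpose 0F 2F ⟨$⟩ʳ_)
realised-02 = realise (mk↔ₛ′ reroot reroot reroot-involutive reroot-involutive)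
  (λ F → trans (edgesˢ-rerootOnto F ε) (ℕ.+-identityʳ _))
  (λ F → cong₂ (λ r l → larmˢ (reroot F) ∸ 1 ∷ r ∸ 1 ∷ l ∸ 1 ∷ [])
    (trans (rarmˢ-rerootOnto F ε) (ℕ.+-identityʳ _)) (cong larmˢ (reroot-involutive F)))

larm-decode : ∀ {m} (c : Code m) → larm (tree (decode c)) ≡ ifPos m (lastRun (runs c))
larm-decode c = trans (larm-tree (decode c)) (larmˢ-decode c)

rarm-decode : ∀ {m} (c : Code m) → rarm (tree (decode c)) ≡ ifPos m (height c)
rarm-decode c = trans (rarm-tree (decode c)) (rarmˢ-decode c)

legs-decode : ∀ {m} (c : Code m) → legs (decode c) ≡ lastRun (runs c) ∷ height c ∷ gap c ∷ []
legs-decode empty              = refl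
legs-decode c@(attach _ _ _ _) = cong₂ (λ k v → k ∸ 1 ∷ v) (larmˢ-decode c)
  (cong₂ (λ k l → k ∸ 1 ∷ l ∸ 1 ∷ []) (rarmˢ-decode c) (larmˢ-reroot-decode c))

exponents-decode : ∀ {m} (c : Code m) →
  exponents (tree (decode c)) ≡ lastRun (runs c) ∷ height c ∷ lastStat 1 c ∷ []
exponents-decode empty              = refl
exponents-decode c@(attach _ _ _ _) = cong₂ (λ k v → k ∸ 1 ∷ v) (larm-decode c)
  (cong₂ (λ k l → k ∸ 1 ∷ l ∸ 1 ∷ []) (rarm-decode c) (rev-decode c))

edgesˢ-onCode : (f : ∀ {m} → Code m ↔ Code m) →
  (∀ {m} (c : Code m) → runs (Inverse.to f c) ≡ runs c) →
  ∀ F → edgesˢ (Inverse.to (onCode f) F) ≡ edgesˢ F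
edgesˢ-onCode f runs-f F = begin
  edgesˢ (decode (Inverse.to f c))  ≡⟨ edgesˢ-decode (Inverse.to f c) ⟩
  total (runs (Inverse.to f c))     ≡⟨ cong total (runs-f c) ⟩
  total (runs c)                    ≡⟨ edgesˢ-decode c ⟨
  edgesˢ (decode c)                 ≡⟨ cong edgesˢ (decode-encode F) ⟩
  edgesˢ F                          ∎
  where
  open ≡-Reasoning
  c = proj₂ (encode F)

realised-12 : Realised (transpose 1F 2F ⟨$⟩ʳ_)
realised-12 = realise (onCode turn↔) (edgesˢ-onCode turn↔ runs-turn) legs-turn
  where
  open ≡-Reasoning
  legs-turn : ∀ F → legs (Inverse.to (onCode turn↔) F) ≡ permute (transpose 1F 2F ⟨$⟩ʳ_) (legs F)
  legs-turn F = begin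
    legs (decode (turn c))                                          ≡⟨ legs-decode (turn c) ⟩
    lastRun (runs (turn c)) ∷ height (turn c) ∷ gap (turn c) ∷ []
      ≡⟨ cong₂ _∷_ (cong lastRun (runs-turn c))
           (cong₂ (λ k l → k ∷ l ∷ []) (height-turn c) (gap-turn c)) ⟩
    lastRun (runs c) ∷ gap c ∷ height c ∷ []                   ≡⟨ cong (permute (transpose 1F 2F ⟨$⟩ʳ_)) (legs-decode c) ⟨
    permute (transpose 1F 2F ⟨$⟩ʳ_) (legs (decode c))               ≡⟨ cong (permute (transpose 1F 2F ⟨$⟩ʳ_) ∘ legs) (decode-encode F) ⟩
    permute (transpose 1F 2F ⟨$⟩ʳ_) (legs F)                        ∎
    where c = proj₂ (encode F)

-- The transposition (0 1) is (1 2) conjugated by (0 2).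
realised-01 : Realised (transpose 0F 1F ⟨$⟩ʳ_)
realised-01 = realised-cong (λ { 0F → refl ; 1F → refl ; 2F → refl })
  (realised-∘ realised-02 (realised-∘ realised-12 realised-02))

realised-transpose : ∀ i j → Realised (transpose i j ⟨$⟩ʳ_)
realised-transpose 0F 1F = realised-01
realised-transpose 0F 2F = realised-02
realised-transpose 1F 2F = realised-12
realised-transpose 1F 0F = realised-cong (λ { 0F → refl ; 1F → refl ; 2F → refl }) realised-01
realised-transpose 2F 0F = realised-cong (λ { 0F → refl ; 1F → refl ; 2F → refl }) realised-02
realised-transpose 2F 1F = realised-cong (λ { 0F → refl ; 1F → refl ; 2F → refl }) realised-12
realised-transpose 0F 0F = realised-cong (λ { 0F → refl ; 1F → refl ; 2F → refl }) realised-id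
realised-transpose 1F 1F = realised-cong (λ { 0F → refl ; 1F → refl ; 2F → refl }) realised-id
realised-transpose 2F 2F = realised-cong (λ { 0F → refl ; 1F → refl ; 2F → refl }) realised-id

realised-eval : ∀ ts → Realised (eval ts ⟨$⟩ʳ_)
realised-eval []             = realised-id
realised-eval ((i , j) ∷ ts) = realised-∘ (realised-eval ts) (realised-transpose i j)

-- Transpositions generate the symmetric group.
realised-permutation : (σ : Permutation′ 3) → Realised (σ ⟨$⟩ʳ_)
realised-permutation σ = realised-cong (eval-decompose σ) (realised-eval (decompose σ))

-- Symmetry of the generating polynomial

trees-↭ : (f : Tree ↔ Tree) → (∀ T → edges (Inverse.to f T) ≡ edges T) →
          ∀ n → map (Inverse.to f) (trees n) ↭ trees n
-- Both lists are free of repetitions, so having the same elements suffices.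
trees-↭ f pres n = ∼bag⇒↭ (unique∧set⇒bag
  (Unique.map⁺ (λ eq → trans (sym (strictlyInverseʳ _)) (trans (cong from eq) (strictlyInverseʳ _))) (trees-unique n))
  (trees-unique n) (mk⇔ ⊆ ⊇))
  where
  open Inverse f
  ⊆ : ∀ {T} → T ∈ map to (trees n) → T ∈ trees n
  ⊆ p with U , q , refl ← ∈-map⁻ to p =
    Equivalence.from ∈-trees (trans (pres U) (Equivalence.to (∈-trees {n}) q))
  ⊇ : ∀ {T} → T ∈ trees n → T ∈ map to (trees n)
  ⊇ {T} p = subst (_∈ map to (trees n)) (strictlyInverseˡ T) (∈-map⁺ to (Equivalence.from ∈-trees
    (trans (sym (pres (from T))) (trans (cong edges (strictlyInverseˡ T)) (Equivalence.to (∈-trees {n}) p)))))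

coeffOf : ∀ {k} → Exponents k → Exponents k → ℤ
coeffOf d e = if does (≡-dec ℕ._≟_ d e) then 1ℤ else 0ℤ

∑-↭ : ∀ {k} {A : Set} (e : A → Exponents k) {xs ys} → xs ↭ ys →
      ∑ xs (monomial ∘ e) ≈ ∑ ys (monomial ∘ e)
∑-↭ e ↭.refl                   d = refl
∑-↭ e (↭.prep x p)             d = cong (λ c → coeffOf (e x) d ℤ.+ c) (∑-↭ e p d)
∑-↭ e (↭.swap {ys = ys} x y p) d = trans
  (cong (λ c → coeffOf (e x) d ℤ.+ (coeffOf (e y) d ℤ.+ c)) (∑-↭ e p d))
  (x∙yz≈y∙xz (coeffOf (e x) d) (coeffOf (e y) d) (coeff (∑ ys (monomial ∘ e)) d))
∑-↭ e (↭.trans p q)            d = trans (∑-↭ e p d) (∑-↭ e q d)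

permuteVars-∑ : ∀ {A : Set} (σ : Permutation′ 3) (e : A → Exponents 3) xs →
  permuteVars σ (∑ xs (monomial ∘ e)) ≡ ∑ xs (monomial ∘ permute (σ ⟨$⟩ˡ_) ∘ e)
permuteVars-∑ σ e []       = refl
permuteVars-∑ σ e (x ∷ xs) = cong (_ ∷_) (permuteVars-∑ σ e xs)

legs-carry : ∀ F → legs (Inverse.to (onCode (carry↔ 1)) F) ≡ exponents (tree F)
legs-carry F = begin
  legs (decode (carry 1 c))                             ≡⟨ legs-decode (carry 1 c) ⟩
  lastRun (runs (carry 1 c)) ∷ height (carry 1 c) ∷ gap (carry 1 c) ∷ []
    ≡⟨ cong₂ _∷_ (cong lastRun (runs-carry 1 c))
         (cong₂ (λ k l → k ∷ l ∷ []) (carry-height 1 c) (gap-carry 1 c)) ⟩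
  lastRun (runs c) ∷ height c ∷ lastStat 1 c ∷ []        ≡⟨ exponents-decode c ⟨
  exponents (tree (decode c))                        ≡⟨ cong (exponents ∘ tree) (decode-encode F) ⟩
  exponents (tree F)                                 ∎
  where
  open ≡-Reasoning
  c = proj₂ (encode F)

edges-onSForest : (f : SForest ↔ SForest) → (∀ F → edgesˢ (Inverse.to f F) ≡ edgesˢ F) →
                  ∀ T → edges (Inverse.to (onSForest f) T) ≡ edges T
edges-onSForest f pres T = begin
  edges (tree (Inverse.to f F))  ≡⟨ edges-tree (Inverse.to f F) ⟩
  edgesˢ (Inverse.to f F)        ≡⟨ pres F ⟩
  edgesˢ F                       ≡⟨ edges-tree F ⟨
  edges (tree F)                 ≡⟨ cong edges (Inverse.strictlyInverseʳ Tree↔SForest T) ⟩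
  edges T                        ∎
  where
  open ≡-Reasoning
  F = Inverse.to Tree↔SForest T

C-symmetric : ∀ n → Symmetric (C n)
C-symmetric n σ d = begin
  coeff (permuteVars σ (C n)) d                         ≡⟨ cong (λ p → coeff p d) (permuteVars-∑ σ exponents (trees n)) ⟩
  coeff (∑ (trees n) (monomial ∘ permute π ∘ exponents)) d
    ≡⟨ cong (λ p → coeff p d) (concatMap-cong (λ T → cong monomial (exponents-g T)) (trees n)) ⟨
  coeff (∑ (trees n) (monomial ∘ exponents ∘ Inverse.to g)) d
    ≡⟨ cong (λ p → coeff p d) (concatMap-map (monomial ∘ exponents) (Inverse.to g) (trees n)) ⟨
  coeff (∑ (map (Inverse.to g) (trees n)) (monomial ∘ exponents)) d
    ≡⟨ ∑-↭ exponents (trees-↭ g (edges-onSForest f edgesˢ-f) n) d ⟩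
  coeff (C n) d                                         ∎
  where
  open ≡-Reasoning
  π = σ ⟨$⟩ˡ_
  -- `permuteVars` reads exponents through the inverse of `σ`, hence `flip`.
  open Realised (realised-permutation (flip σ)) renaming (bijection to h)
  κ f : SForest ↔ SForest
  κ = onCode (carry↔ 1)
  -- Conjugation by `κ` moves the action on the legs to the exponents involving `rev`.
  f = ↔-sym κ ↔-∘ (h ↔-∘ κ)
  g = onSForest f
  edgesˢ-κ : ∀ F → edgesˢ (Inverse.to κ F) ≡ edgesˢ F
  edgesˢ-κ = edgesˢ-onCode (carry↔ 1) (runs-carry 1)
  κ-f : ∀ F → Inverse.to κ (Inverse.to f F) ≡ Inverse.to h (Inverse.to κ F)
  κ-f F = Inverse.strictlyInverseˡ κ _
  edgesˢ-f : ∀ F → edgesˢ (Inverse.to f F) ≡ edgesˢ F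
  edgesˢ-f F = begin
    edgesˢ (Inverse.to f F)                 ≡⟨ edgesˢ-κ (Inverse.to f F) ⟨
    edgesˢ (Inverse.to κ (Inverse.to f F))  ≡⟨ cong edgesˢ (κ-f F) ⟩
    edgesˢ (Inverse.to h (Inverse.to κ F))  ≡⟨ edges-fixed (Inverse.to κ F) ⟩
    edgesˢ (Inverse.to κ F)                 ≡⟨ edgesˢ-κ F ⟩
    edgesˢ F                                ∎
  exponents-g : ∀ T → exponents (Inverse.to g T) ≡ permute π (exponents T)
  exponents-g T = begin
    exponents (tree (Inverse.to f F))     ≡⟨ legs-carry (Inverse.to f F) ⟨
    legs (Inverse.to κ (Inverse.to f F))  ≡⟨ cong legs (κ-f F) ⟩
    legs (Inverse.to h (Inverse.to κ F))  ≡⟨ legs-permuted (Inverse.to κ F) ⟩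
    permute π (legs (Inverse.to κ F))     ≡⟨ cong (permute π) (legs-carry F) ⟩
    permute π (exponents (tree F))        ≡⟨ cong (permute π ∘ exponents) (Inverse.strictlyInverseʳ Tree↔SForest T) ⟩
    permute π (exponents T)               ∎
    where F = Inverse.to Tree↔SForest T

-- The bijection taking `rev` to `run`

ψ : ∀ {m} → Code m ↔ Code m
ψ = ↔-sym (carry↔ 0) ↔-∘ carry↔ 1

carry-ψ : ∀ {m} (c : Code m) → carry 0 (Inverse.to ψ c) ≡ carry 1 c
carry-ψ c = carry-carry⁻¹ 0 (carry 1 c)

runs-ψ : ∀ {m} (c : Code m) → runs (Inverse.to ψ c) ≡ runs c
runs-ψ c = begin
  runs (Inverse.to ψ c)            ≡⟨ runs-carry 0 (Inverse.to ψ c) ⟨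
  runs (carry 0 (Inverse.to ψ c))  ≡⟨ cong runs (carry-ψ c) ⟩
  runs (carry 1 c)                 ≡⟨ runs-carry 1 c ⟩
  runs c                           ∎
  where open ≡-Reasoning

height-ψ : ∀ {m} (c : Code m) → height (Inverse.to ψ c) ≡ height c
height-ψ c = trans (carry⁻¹-height 0 (carry 1 c)) (carry-height 1 c)

-- Both sides are the gap of the common image `carry 1 c`.
lastStat-ψ : ∀ {m} (c : Code m) → lastStat 1 c ≡ lastStat 0 (Inverse.to ψ c)
lastStat-ψ c = begin
  lastStat 1 c                    ≡⟨ gap-carry 1 c ⟨
  gap (carry 1 c)                 ≡⟨ cong gap (carry-ψ c) ⟨
  gap (carry 0 (Inverse.to ψ c))  ≡⟨ gap-carry 0 (Inverse.to ψ c) ⟩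
  lastStat 0 (Inverse.to ψ c)     ∎
  where open ≡-Reasoning

leaf-decode : ∀ {m} (c : Code m) → leaf (tree (decode c)) ≡ suc (pred m)
leaf-decode c = trans (leaf-tree (decode c)) (leafˢ-decode c)

Ψ : Tree ↔ Tree
Ψ = onSForest (onCode ψ)

edges-Ψ : ∀ T → edges (Inverse.to Ψ T) ≡ edges T
edges-Ψ = edges-onSForest (onCode ψ) (edgesˢ-onCode ψ runs-ψ)

Transports : Tree → Tree → Set
Transports U T = larm U ≡ larm T × rarm U ≡ rarm T × leaf U ≡ leaf T × rev T ≡ run U

Ψ-transports : ∀ T → Transports (Inverse.to Ψ T) T
Ψ-transports T = subst (Transports (Inverse.to Ψ T))
  (trans (cong tree (decode-encode F)) (Inverse.strictlyInverseʳ Tree↔SForest T))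
  (on-code (proj₂ (encode F)))
  where
  F = Inverse.to Tree↔SForest T
  on-code : ∀ {m} (c : Code m) → Transports (tree (decode (Inverse.to ψ c))) (tree (decode c))
  on-code {m} c =
    trans (larm-decode c′) (trans (cong (ifPos m ∘ lastRun) (runs-ψ c)) (sym (larm-decode c))) ,
    trans (rarm-decode c′) (trans (cong (ifPos m) (height-ψ c)) (sym (rarm-decode c))) ,
    -- The index `m`, kept by `ψ`, determines the number of leaves.
    trans (leaf-decode c′) (sym (leaf-decode c)) ,
    trans (rev-decode c) (trans (cong (ifPos m) (lastStat-ψ c)) (sym (run-decode c′)))
    where c′ = Inverse.to ψ c

theorem3p6 : ∀ (n : ℕ) → 1 ≤ n →
    (Σ[ Ψ ∈ 𝒫 n ⤖ 𝒫 n ]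
    (∀ (T : 𝒫 n) →
    larm (proj₁ (Bijection.to Ψ T)) ≡ larm (proj₁ T) ×
    rarm (proj₁ (Bijection.to Ψ T)) ≡ rarm (proj₁ T) ×
    leaf (proj₁ (Bijection.to Ψ T)) ≡ leaf (proj₁ T) ×
    rev (proj₁ T) ≡ run (proj₁ (Bijection.to Ψ T))))
    × Symmetric (C n)
theorem3p6 n _ = (↔⇒⤖ (restrict Ψ edges-Ψ n) , Ψ-transports ∘ proj₁) , C-symmetric n
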